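{- Let $\mathbf{var}$ be a countably infinite set. Every projectional semilattice is isomorphic to a conjunctive table algebra (with equality). That is, for every projectional semilattice $(V,\wedge,0,1,c_x,d_{xy},\mathrm{dom})_{x,y\in\mathbf{var}}$ there are a set $G$, a subalgebra of $\mathbf{Tab}(G)$ with universe $A\subseteq\mathrm{Tab}(G)$, and a bijection $\varphi:V\to A$ such that for all $u,v\in V$ and $x,y\in\mathbf{var}$: $\varphi(u\wedge v)=\varphi(u)\Join\varphi(v)$, $\varphi(0)=\emptyset$, $\varphi(1)=\{\langle\rangle\}$, $\varphi(c_x(u))=\mathrm{del}_x(\varphi(u))$, $\varphi(d_{xy})=E_{xy}$, and $\mathrm{schema}(\varphi(u))=\mathrm{dom}(u)$.
   Context: **Tables.** $\mathfrak{P}_{\mathrm{fin}}(\mathbf{var})$ is the set of finite subsets of $\mathbf{var}$. A table over $G$ is a set $T\subseteq G^X$ of functions $X\to G$, for some $X\in\mathfrak{P}_{\mathrm{fin}}(\mathbf{var})$; $\mathrm{Tab}(G)=\bigcup\{\mathfrak{P}(G^X)\mid X\in\mathfrak{P}_{\mathrm{fin}}(\mathbf{var})\}$ is the set of all tables over $G$ (there is a single empty table $\emptyset$). The function $\mathrm{schema}:\mathrm{Tab}(G)\to\mathfrak{P}(\mathbf{var})$ is given by $\mathrm{schema}(T)=X$ if $\emptyset\neq T\subseteq G^X$, and $\mathrm{schema}(\emptyset)=\mathbf{var}$. $\langle\rangle$ is the unique element of $G^{\emptyset}$. - Natural join: for nonempty $T_1\subseteq G^{X_1}$, $T_2\subseteq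 G^{X_2}$, $T_1\Join T_2=\{t\in G^{X_1\cup X_2}\mid t|_{X_1}\in T_1 \text{ and } t|_{X_2}\in T_2\}$; and $\emptyset\Join T=T\Join\emptyset=\emptyset$. - Deletion: for $T\subseteq G^X$, $\mathrm{del}_x(T)=\{t|_{X\setminus\{x\}}\mid t\in T\}$ (so $\mathrm{del}_x(\emptyset)=\emptyset$). - Equality tables: $E_{xy}=\{t\in G^{\{x,y\}}\mid t(x)=t(y)\}$ for $x,y\in\mathbf{var}$ (possibly $x=y$). $\mathbf{Tab}(G)=(\mathrm{Tab}(G),\Join,\emptyset,\{\langle\rangle\},\mathrm{del}_x,E_{xy},\mathrm{schema})_{x,y\in\mathbf{var}}$. A conjunctive table algebra (with equality) with base $G$ is a subalgebra of $\mathbf{Tab}(G)$, i.e. a subset $A\subseteq\mathrm{Tab}(G)$ containing $\emptyset$, $\{\langle\rangle\}$ and all $E_{xy}$, closed under $\Join$ and all $\mathrm{del}_x$, equipped with the restricted operations. **Projectional semilattice.** An algebra $(V,\wedge,0,1,c_x,d_{xy},\mathrm{dom})_{x,y\in\mathbf{var}}$ with a binary operation $\wedge$ on $V$, elements $0,1\in V$, functions $c_x:V\to V$ ($x\in\mathbf{var}$), elements $d_{xy}\in V$ ($x,y\in\mathbf{var}$), and a function $\mathrm{dom}:V\to\mathfrak{P}(\mathbf{var})$, such that for all $u,v\in V$ and $x,y,z\in\mathbf{var}$ (where $u\le v$ means $u=u\wedge v$): - (PS0) $(V,\wedge,0,1)$ is a bounded semilattice ($\wedge$ is associative, commutative and idempotent,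 with least element $0$ and greatest element $1$) - (PS1) $c_x(0)=0$ - (PS2) $u\le c_x(u)$ - (PS3) $c_x(u\wedge c_x(v))=c_x(u)\wedge c_x(v)$ - (PS4) $c_x(c_y(u))=c_y(c_x(u))$ - (PS5) $u\neq 0\Rightarrow(u\neq c_x(u)\Leftrightarrow u\le d_{xx})$ - (PS6) if $x\neq y$ and $x\neq z$, then $d_{yz}=c_x(d_{yx}\wedge d_{xz})$ - (PS7) $x\neq y\Rightarrow d_{xy}\wedge c_x(d_{xy}\wedge u)\le u$ - (PS8) $u\neq0\Rightarrow\mathrm{dom}(u)$ is finite - (PS9) $\mathrm{dom}(u)=\{x\in\mathbf{var}\mid u\le d_{xx}\}$ - (PS10) $\mathrm{dom}(u)=\emptyset\Rightarrow u=1$ - (PS11) $d_{xx}\neq0$ - (PS12) $d_{xy}=d_{yx}$ -}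

module Defs where

open import Algebra.Core using (Op₁; Op₂)
open import Algebra.Lattice.Structures using (IsBoundedMeetSemilattice)
open import Data.Empty using (⊥; ⊥-elim)
open import Data.List.Base using (List; []; _∷_; _++_; filter)
open import Data.List.Membership.Propositional using (_∈_)
import Data.List.Membership.DecPropositional as DecMembership
open import Data.List.Membership.Propositional.Properties
  using (∈-++⁺ˡ; ∈-++⁺ʳ; ∈-++⁻; ∈-filter⁺; ∈-filter⁻)
open import Data.Maybe using (Maybe; just; nothing; Is-just)
open import Data.Maybe.Relation.Unary.Any using (just)
import Data.Maybe.Relation.Binary.Pointwise as Maybe
open import Data.Nat.Base using (ℕ)
import Data.Nat.Properties as ℕ
open import Data.Product.Base using (Σ; ∃-syntax; _×_; _,_; proj₁; proj₂)
open import Data.Sum.Base using (inj₁; inj₂)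
open import Function.Bundles using (_⇔_; _↔_; Bijection)
open import Function.Properties.Inverse using (↔⇒↣)
open import Level using (_⊔_; suc; Lift)
open import Relation.Binary.Bundles using (Setoid)
import Relation.Binary.Construct.On as On
open import Relation.Binary.Core using (Rel; _Preserves_⟶_)
open import Relation.Binary.Definitions
  using (DecidableEquality; Minimum; _Respects_)
open import Relation.Binary.PropositionalEquality.Core using (_≢_)
open import Relation.Nullary.Decidable using (yes; no; ¬?; via-injection)
open import Relation.Nullary.Negation using (¬_)
open import Relation.Unary using (Pred; _≐_; Empty; Satisfiable)
open import Relation.Unary.Relation.Binary.Equality using (≐-setoid)

-- Finite subsets of a type are represented by lists of their elements.
-- Repetitions and order are irrelevant: lists are only ever compared
-- through their membership predicates.

Finite : ∀ {a p} {A : Set a} → Pred A p → Set (a ⊔ p)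
Finite P = ∃[ xs ] P ≐ (_∈ xs)

record ProjectionalSemilattice {v} (var : Set v) c ℓ d
  : Set (v ⊔ suc (c ⊔ ℓ ⊔ d)) where
  infixr 7 _∧_
  infix  4 _≈_ _≤_ _≉_
  field
    Carrier : Set c
    _≈_     : Rel Carrier ℓ
    _∧_     : Op₂ Carrier
    0#      : Carrier
    1#      : Carrier
    c⟨_⟩    : var → Op₁ Carrier
    d⟨_,_⟩  : var → var → Carrier
    dom     : Carrier → Pred var d

  _≤_ : Rel Carrier ℓ
  u ≤ v = u ≈ u ∧ v

  _≉_ : Rel Carrier ℓ
  u ≉ v = ¬ (u ≈ v)

  field
    c-cong  : ∀ x → c⟨ x ⟩ Preserves _≈_ ⟶ _≈_
    ps0     : IsBoundedMeetSemilattice _≈_ _∧_ 1#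
    0-least : Minimum _≤_ 0#
    ps1     : ∀ x → c⟨ x ⟩ 0# ≈ 0#
    ps2     : ∀ x u → u ≤ c⟨ x ⟩ u
    ps3     : ∀ x u v → c⟨ x ⟩ (u ∧ c⟨ x ⟩ v) ≈ c⟨ x ⟩ u ∧ c⟨ x ⟩ v
    ps4     : ∀ x y u → c⟨ x ⟩ (c⟨ y ⟩ u) ≈ c⟨ y ⟩ (c⟨ x ⟩ u)
    ps5     : ∀ x u → u ≉ 0# → (u ≉ c⟨ x ⟩ u) ⇔ (u ≤ d⟨ x , x ⟩)
    ps6     : ∀ x y z → x ≢ y → x ≢ z →
              d⟨ y , z ⟩ ≈ c⟨ x ⟩ (d⟨ y , x ⟩ ∧ d⟨ x , z ⟩)
    ps7     : ∀ x y u → x ≢ y → d⟨ x , y ⟩ ∧ c⟨ x ⟩ (d⟨ x , y ⟩ ∧ u) ≤ u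
    ps8     : ∀ u → u ≉ 0# → Finite (dom u)
    ps9     : ∀ u → dom u ≐ (λ x → u ≤ d⟨ x , x ⟩)
    ps10    : ∀ u → Empty (dom u) → u ≈ 1#
    ps11    : ∀ x → d⟨ x , x ⟩ ≉ 0#
    ps12    : ∀ x y → d⟨ x , y ⟩ ≈ d⟨ y , x ⟩

  open IsBoundedMeetSemilattice _≈_ ps0 public using (isEquivalence)

  setoid : Setoid c ℓ
  setoid = record { isEquivalence = isEquivalence }

module Tables {v} {var : Set v} (var↔ℕ : var ↔ ℕ) {g e} (G : Setoid g e) where

  private module G = Setoid G

  infix 4 _≟_
  _≟_ : DecidableEquality var
  _≟_ = via-injection (↔⇒↣ var↔ℕ) ℕ._≟_

  open DecMembership _≟_ using (_∈?_)

  -- A function from a finite X ⊆ var to G is encoded as a partial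
  -- function on var whose domain of definition is X.  Thus the elements
  -- of all the sets G^X live in a single type, and in particular there
  -- is just one empty table.

  Row : Set (v ⊔ g)
  Row = var → Maybe G.Carrier

  infix 4 _≈ᵍ_ _≈ʳ_
  _≈ᵍ_ : Rel (Maybe G.Carrier) (g ⊔ e)
  _≈ᵍ_ = Maybe.Pointwise G._≈_

  _≈ʳ_ : Rel Row (v ⊔ g ⊔ e)
  s ≈ʳ t = ∀ x → s x ≈ᵍ t x

  infix 4 _∈G^_
  _∈G^_ : Row → List var → Set (v ⊔ g)
  t ∈G^ X = (λ x → Is-just (t x)) ≐ (_∈ X)

  ⟨⟩ : Row
  ⟨⟩ _ = nothing

  infixl 8 _∣_
  _∣_ : Row → List var → Row
  (t ∣ X) x with x ∈? X
  ... | yes _ = t x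
  ... | no  _ = nothing

  infixl 6 _∖_
  _∖_ : List var → var → List var
  X ∖ x = filter (λ y → ¬? (y ≟ x)) X

  record Table : Set (suc (v ⊔ g ⊔ e)) where
    field
      rows      : Pred Row (v ⊔ g ⊔ e)
      rows-resp : rows Respects _≈ʳ_
      columns   : List var
      rows⊆G^   : ∀ {t} → rows t → t ∈G^ columns

  open Table public

  -- Equality of tables as sets of rows; the choice of columns does not
  -- matter (it is determined by the rows unless the table is empty).

  infix 4 _≋_
  _≋_ : Rel Table (v ⊔ g ⊔ e)
  S ≋ T = rows S ≐ rows T

  tableSetoid : Setoid (suc (v ⊔ g ⊔ e)) (v ⊔ g ⊔ e)
  tableSetoid = On.setoid (≐-setoid Row (v ⊔ g ⊔ e)) rows

  NonEmpty : Pred Table (v ⊔ g ⊔ e)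
  NonEmpty T = Satisfiable (rows T)

  -- The columns of T if T is nonempty, all of var otherwise: see
  -- schema-nonempty and schema-empty.

  schema : Table → Pred var (v ⊔ g ⊔ e)
  schema T x = NonEmpty T → x ∈ columns T

  schema-nonempty : ∀ T → NonEmpty T → schema T ≐ (_∈ columns T)
  schema-nonempty T ne = (λ f → f ne) , (λ x∈X _ → x∈X)

  schema-empty : ∀ T → ¬ NonEmpty T → ∀ x → schema T x
  schema-empty T e x ne = ⊥-elim (e ne)

  private
    ≈ʳ-refl : ∀ {t} → t ≈ʳ t
    ≈ʳ-refl x = Maybe.refl G.refl

    ≈ʳ-sym : ∀ {s t} → s ≈ʳ t → t ≈ʳ s
    ≈ʳ-sym s≈t x = Maybe.sym G.sym (s≈t x)

    ≈ʳ-trans : ∀ {s t r} → s ≈ʳ t → t ≈ʳ r → s ≈ʳ r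
    ≈ʳ-trans s≈t t≈r x = Maybe.trans G.trans (s≈t x) (t≈r x)

    is-just-resp : ∀ {a b} → a ≈ᵍ b → Is-just a → Is-just b
    is-just-resp (Maybe.just _) (just _) = just _

    ∈G^-resp : ∀ {s t X} → s ≈ʳ t → s ∈G^ X → t ∈G^ X
    ∈G^-resp s≈t (p , q) =
      (λ {x} j → p (is-just-resp (Maybe.sym G.sym (s≈t x)) j)) ,
      (λ {x} m → is-just-resp (s≈t x) (q m))

    ∣-congˡ : ∀ X {s t} → s ≈ʳ t → s ∣ X ≈ʳ t ∣ X
    ∣-congˡ X s≈t x with x ∈? X
    ... | yes _ = s≈t x
    ... | no  _ = Maybe.nothing

    ∣-congʳ : ∀ {X Y} t → (_∈ X) ≐ (_∈ Y) → t ∣ X ≈ʳ t ∣ Y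
    ∣-congʳ {X} {Y} t (p , q) x with x ∈? X | x ∈? Y
    ... | yes _ | yes _ = ≈ʳ-refl {t} x
    ... | no  _ | no  _ = Maybe.nothing
    ... | yes a | no  b = ⊥-elim (b (p a))
    ... | no  a | yes b = ⊥-elim (a (q b))

    ∖-⊆ : ∀ X x {y} → y ∈ X ∖ x → y ∈ X
    ∖-⊆ X x y∈ = proj₁ (∈-filter⁻ (λ y → ¬? (y ≟ x)) {xs = X} y∈)

    ∣-∈G^ : ∀ {X Y t} → t ∈G^ X → (∀ {y} → y ∈ Y → y ∈ X) → t ∣ Y ∈G^ Y
    ∣-∈G^ {X} {Y} {t} (_ , q) Y⊆X = to , from
      where
      to : ∀ {y} → Is-just ((t ∣ Y) y) → y ∈ Y
      to {y} j with x ← y ∈? Y with yes m ← x = m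
      from : ∀ {y} → y ∈ Y → Is-just ((t ∣ Y) y)
      from {y} m with y ∈? Y
      ... | yes _ = q (Y⊆X m)
      ... | no  n = ⊥-elim (n m)

  ∅ : Table
  ∅ = record
    { rows      = λ _ → Lift _ ⊥
    ; rows-resp = λ _ ()
    ; columns   = []
    ; rows⊆G^   = λ ()
    }

  ｛⟨⟩｝ : Table
  ｛⟨⟩｝ = record
    { rows      = _≈ʳ ⟨⟩
    ; rows-resp = λ s≈t s≈⟨⟩ → ≈ʳ-trans (≈ʳ-sym s≈t) s≈⟨⟩
    ; columns   = []
    ; rows⊆G^   = λ t≈⟨⟩ → ∈G^-resp (≈ʳ-sym t≈⟨⟩) ((λ ()) , (λ ()))
    }

  -- If S or T is empty then so is S ⋈ T, whatever its columns.

  infixr 7 _⋈_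
  _⋈_ : Table → Table → Table
  S ⋈ T = record
    { rows      = λ t → (t ∈G^ columns S ++ columns T)
                      × rows S (t ∣ columns S)
                      × rows T (t ∣ columns T)
    ; rows-resp = λ s≈t (d , a , b) →
        ∈G^-resp s≈t d ,
        rows-resp S (∣-congˡ (columns S) s≈t) a ,
        rows-resp T (∣-congˡ (columns T) s≈t) b
    ; columns   = columns S ++ columns T
    ; rows⊆G^   = proj₁
    }

  del : var → Table → Table
  del x T = record
    { rows      = λ s → ∃[ t ] rows T t × s ≈ʳ t ∣ (columns T ∖ x)
    ; rows-resp = λ s≈s′ (t , t∈T , s≈) →
        t , t∈T , ≈ʳ-trans (≈ʳ-sym s≈s′) s≈
    ; columns   = columns T ∖ x
    ; rows⊆G^   = λ (t , t∈T , s≈) →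
        ∈G^-resp (≈ʳ-sym s≈) (∣-∈G^ (rows⊆G^ T t∈T) (∖-⊆ (columns T) x))
    }

  E : var → var → Table
  E x y = record
    { rows      = λ t → (t ∈G^ x ∷ y ∷ []) × t x ≈ᵍ t y
    ; rows-resp = λ s≈t (d , sx≈sy) →
        ∈G^-resp s≈t d ,
        Maybe.trans G.trans (Maybe.sym G.sym (s≈t x))
          (Maybe.trans G.trans sx≈sy (s≈t y))
    ; columns   = x ∷ y ∷ []
    ; rows⊆G^   = proj₁
    }

  -- The operations do not depend on the choice of columns.

  columns-unique : ∀ {S T} → S ≋ T → NonEmpty S →
                   (_∈ columns S) ≐ (_∈ columns T)
  columns-unique {S} {T} (S⊆T , _) (s , s∈S)
    with p , q ← rows⊆G^ S s∈S | p′ , q′ ← rows⊆G^ T (S⊆T s∈S)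
    = (λ m → p′ (q m)) , (λ m → p (q′ m))

  schema-cong : ∀ {S T} → S ≋ T → schema S ≐ schema T
  schema-cong {S} {T} (S⊆T , T⊆S) =
    (λ f (t , t∈T) →
      proj₁ (columns-unique {S} {T} (S⊆T , T⊆S) (t , T⊆S t∈T)) (f (t , T⊆S t∈T))) ,
    (λ f (s , s∈S) →
      proj₁ (columns-unique {T} {S} (T⊆S , S⊆T) (s , S⊆T s∈S)) (f (s , S⊆T s∈S)))

  ⋈-cong : ∀ {S S′ T T′} → S ≋ S′ → T ≋ T′ → S ⋈ T ≋ S′ ⋈ T′
  ⋈-cong {S} {S′} {T} {T′} (S⊆ , ⊆S) (T⊆ , ⊆T) =
    ⊆-half {S} {S′} {T} {T′} (S⊆ , ⊆S) (T⊆ , ⊆T) ,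
    ⊆-half {S′} {S} {T′} {T} (⊆S , S⊆) (⊆T , T⊆)
    where
    ⊆-half : ∀ {S S′ T T′} → S ≋ S′ → T ≋ T′ →
             ∀ {t} → rows (S ⋈ T) t → rows (S′ ⋈ T′) t
    ⊆-half {S} {S′} {T} {T′} S≋ T≋ {t} ((p , q) , a , b) =
      ( (λ j → ++-mono (proj₁ X≐) (proj₁ Y≐) (p j))
      , (λ m → q (++-mono (proj₂ X≐) (proj₂ Y≐) m)) ) ,
      rows-resp S′ (∣-congʳ t X≐) (proj₁ S≋ a) ,
      rows-resp T′ (∣-congʳ t Y≐) (proj₁ T≋ b)
      where
      X≐ = columns-unique {S} {S′} S≋ (_ , a)
      Y≐ = columns-unique {T} {T′} T≋ (_ , b)
      ++-mono : ∀ {X X′ Y Y′ : List var} {x} →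
                (∀ {x} → x ∈ X → x ∈ X′) → (∀ {x} → x ∈ Y → x ∈ Y′) →
                x ∈ X ++ Y → x ∈ X′ ++ Y′
      ++-mono {X} {X′} f g m with ∈-++⁻ X m
      ... | inj₁ l = ∈-++⁺ˡ (f l)
      ... | inj₂ r = ∈-++⁺ʳ X′ (g r)

  del-cong : ∀ x {S T} → S ≋ T → del x S ≋ del x T
  del-cong x {S} {T} (S⊆T , T⊆S) =
    ⊆-half {S} {T} (S⊆T , T⊆S) , ⊆-half {T} {S} (T⊆S , S⊆T)
    where
    ∖-mono : ∀ {X Y : List var} → (∀ {y} → y ∈ X → y ∈ Y) →
             ∀ {y} → y ∈ X ∖ x → y ∈ Y ∖ x
    ∖-mono {X} f m with y∈X , y≢x ← ∈-filter⁻ (λ y → ¬? (y ≟ x)) {xs = X} m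
      = ∈-filter⁺ (λ y → ¬? (y ≟ x)) (f y∈X) y≢x
    ⊆-half : ∀ {S T} → S ≋ T → ∀ {s} → rows (del x S) s → rows (del x T) s
    ⊆-half {S} {T} S≋T (t , t∈S , s≈)
      with X⊆Y , Y⊆X ← columns-unique {S} {T} S≋T (t , t∈S)
      = t , proj₁ S≋T t∈S , ≈ʳ-trans s≈ (∣-congʳ t (∖-mono X⊆Y , ∖-mono Y⊆X))

  record ConjunctiveTableAlgebra : Set (suc (v ⊔ g ⊔ e)) where
    field
      universe      : Pred Table (v ⊔ g ⊔ e)
      universe-resp : universe Respects _≋_
      ∅-mem         : universe ∅
      ｛⟨⟩｝-mem      : universe ｛⟨⟩｝
      E-mem         : ∀ x y → universe (E x y)
      ⋈-closed      : ∀ {S T} → universe S → universe T → universe (S ⋈ T)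
      del-closed    : ∀ x {T} → universe T → universe (del x T)

    setoid : Setoid (suc (v ⊔ g ⊔ e)) (v ⊔ g ⊔ e)
    setoid = On.setoid {B = Σ Table universe} tableSetoid proj₁

  record Isomorphism {c ℓ d} (V : ProjectionalSemilattice var c ℓ d)
                     (A : ConjunctiveTableAlgebra)
                     : Set (suc (v ⊔ g ⊔ e) ⊔ c ⊔ ℓ ⊔ d) where
    open ProjectionalSemilattice V hiding (setoid)
    field
      bijection : Bijection (ProjectionalSemilattice.setoid V)
                            (ConjunctiveTableAlgebra.setoid A)

    φ : Carrier → Table
    φ u = proj₁ (Bijection.to bijection u)

    field
      φ-∧   : ∀ u v → φ (u ∧ v) ≋ φ u ⋈ φ v
      φ-0   : φ 0# ≋ ∅
      φ-1   : φ 1# ≋ ｛⟨⟩｝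
      φ-c   : ∀ x u → φ (c⟨ x ⟩ u) ≋ del x (φ u)
      φ-d   : ∀ x y → φ d⟨ x , y ⟩ ≋ E x y
      φ-dom : ∀ u → schema (φ u) ≐ dom u

module Submission where

-- Up to the elements d_xx, a projectional semilattice is a locally finite cylindric semilattice
-- (the preorder ≲), in which u ≲ v gives back u ≤ v as soon as dom v ⊆ dom u.  Cylindric
-- semilattices are the Lindenbaum algebras of theories in the logic of ∧, ∃ and =, and the
-- models of these theories come from a Henkin construction inside V: some of the variables
-- serve as constants, and a decreasing sequence of elements collects the facts, where a
-- witness for ∃x v is a fresh constant y together with the fact c_x(d_xy ∧ v).  A fresh y is
-- eliminated again by c_y, so the sequence proves nothing new about its initial element.
--
-- There are not enough variables to provide witnesses for an uncountable V, or to keep columns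
-- and constants apart for all elements at once.  So a model handles only finitely many
-- elements u and the columns below some bound, and G is the reduced product of the models
-- modulo the filter generated by these restrictions; no ultrafilter is needed, because the
-- logic has neither ∨ nor ¬.  Every element u ≠ 0 is the initial element of some model in each
-- set of the filter, which separates u from every v that is not above it.

open import Defs
open import Algebra.Core using (Op₁; Op₂)
open import Algebra.Lattice.Structures using (IsBoundedMeetSemilattice)
open import Axiom.ExcludedMiddle using (ExcludedMiddle)
open import Data.Bool.Base using (if_then_else_)
open import Data.Empty using (⊥-elim)
open import Data.List.Base
  using (List; []; _∷_; _++_; map; filter; foldr; upTo; applyUpTo; cartesianProductWith)
import Data.List.Membership.DecPropositional as DecMembership
open import Data.List.Membership.Propositional using (_∈_)
open import Data.List.Membership.Propositional.Properties
  using (∈-map⁺; ∈-map⁻; ∈-filter⁺; ∈-filter⁻; ∈-upTo⁺; ∈-upTo⁻; ∈-applyUpTo⁺;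
         ∈-cartesianProductWith⁺; ∈-++⁺ˡ; ∈-++⁺ʳ; ∈-++⁻)
open import Data.List.Properties using (map-∘; map-id)
open import Data.List.Relation.Binary.Subset.Propositional using (_⊆_)
open import Data.List.Relation.Unary.All as All using (All; []; _∷_)
import Data.List.Relation.Unary.All.Properties as All
open import Data.List.Relation.Unary.AllPairs as AllPairs using (AllPairs; []; _∷_)
import Data.List.Relation.Unary.AllPairs.Properties as AllPairs
open import Data.List.Relation.Unary.Any using (here; there)
open import Data.List.Relation.Unary.Unique.Propositional using (Unique)
open import Data.List.Relation.Unary.Unique.Propositional.Properties using (upTo⁺; filter⁺)
open import Data.Maybe using (Maybe; just; nothing; maybe; Is-just)
import Data.Maybe.Relation.Binary.Pointwise as Maybe
open import Data.Maybe.Relation.Binary.Pointwise using (just; nothing)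
open import Data.Maybe.Relation.Unary.Any using (just)
open import Data.Nat.Base using (ℕ; zero; suc; _+_; _∸_; _≤_; _<_; s≤s; _≤′_; ≤′-reflexive; ≤′-step)
  renaming (_⊔_ to _⊔ⁿ_)
open import Data.Nat.Binary.Base as ℕᵇ using (ℕᵇ; 2[1+_]; 1+[2_])
open import Data.Nat.Binary.Properties using (fromℕ-toℕ)
import Data.Nat.Properties as ℕ
open import Data.Product.Base using (Σ; ∃; ∃-syntax; _×_; _,_; proj₁; proj₂; swap; map₂)
open import Data.Sum.Base as Sum using (_⊎_; inj₁; inj₂)
open import Function.Base using (_∘_; id; case_of_)
open import Function.Bundles using (_↔_; Inverse; Equivalence)
open import Function.Properties.Inverse using (↔⇒↣)
open import Level using (Level; Lift; _⊔_; lift; lower) renaming (suc to lsuc)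
open import Relation.Binary.Bundles using (Setoid)
import Relation.Binary.Construct.NaturalOrder.Left as Natural
open import Relation.Binary.Core using (Rel)
open import Relation.Binary.Definitions using (DecidableEquality)
open import Relation.Binary.PropositionalEquality
  using (_≡_; _≢_; refl; sym; trans; cong; subst; subst₂)
open import Relation.Binary.Structures using (IsEquivalence)
open import Relation.Nullary.Decidable
  using (Dec; yes; no; does; ¬?; map′; dec-true; dec-false; via-injection)
open import Relation.Nullary.Negation using (¬_; contradiction)
open import Relation.Unary using (_≐_)
open import Relation.Unary.Properties using (≐-trans)

record CylindricSemilattice a ℓ : Set (lsuc (a ⊔ ℓ)) where
  infixr 7 _∧_
  infix  4 _≲_
  field
    Carrier    : Set a
    _≲_        : Rel Carrier ℓ
    _∧_        : Op₂ Carrier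
    0# 1#      : Carrier
    cyl        : ℕ → Op₁ Carrier
    d          : ℕ → ℕ → Carrier
    ≲-refl     : ∀ {u} → u ≲ u
    ≲-trans    : ∀ {u v w} → u ≲ v → v ≲ w → u ≲ w
    ∧-lowerˡ   : ∀ {u v} → u ∧ v ≲ u
    ∧-lowerʳ   : ∀ {u v} → u ∧ v ≲ v
    ∧-greatest : ∀ {u v w} → w ≲ u → w ≲ v → w ≲ u ∧ v
    1-greatest : ∀ {u} → u ≲ 1#
    cyl-mono     : ∀ x {u v} → u ≲ v → cyl x u ≲ cyl x v
    cyl-inc      : ∀ x {u} → u ≲ cyl x u
    cyl-∧        : ∀ x {u v} → cyl x u ∧ cyl x v ≲ cyl x (u ∧ cyl x v)
    cyl-idem     : ∀ x {u} → cyl x (cyl x u) ≲ cyl x u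
    cyl-comm     : ∀ x y {u} → cyl x (cyl y u) ≲ cyl y (cyl x u)
    cyl-0        : ∀ x → cyl x 0# ≲ 0#
    d-refl     : ∀ {x} → 1# ≲ d x x
    d-sym      : ∀ {x y} → d x y ≲ d y x
    d-trans    : ∀ {x y z} → d x y ∧ d y z ≲ d x z
    d-closed   : ∀ {x y z} → z ≢ x → z ≢ y → cyl z (d x y) ≲ d x y
    d-total    : ∀ {x y} → x ≢ y → 1# ≲ cyl x (d x y)
    d-subst    : ∀ {x y u} → x ≢ y → d x y ∧ cyl x (d x y ∧ u) ≲ u
    bound      : ∀ u → ∃[ m ] ∀ k → m ≤ k → cyl k u ≲ u

module CylindricProperties {a ℓ} (W : CylindricSemilattice a ℓ) where
  open CylindricSemilattice W public

  infixr 5 _⨾_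
  _⨾_ : ∀ {u v w} → u ≲ v → v ≲ w → u ≲ w
  _⨾_ = ≲-trans

  Closed : ℕ → Carrier → Set ℓ
  Closed x u = cyl x u ≲ u

  ∧-mono : ∀ {u u′ v v′} → u ≲ u′ → v ≲ v′ → u ∧ v ≲ u′ ∧ v′
  ∧-mono p q = ∧-greatest (∧-lowerˡ ⨾ p) (∧-lowerʳ ⨾ q)

  ∧-closed : ∀ {x u v} → Closed x u → Closed x v → Closed x (u ∧ v)
  ∧-closed {x} p q = ∧-greatest (cyl-mono x ∧-lowerˡ ⨾ p) (cyl-mono x ∧-lowerʳ ⨾ q)

  1-closed : ∀ {x} → Closed x 1#
  1-closed = 1-greatest

  cyl-closed : ∀ {x} y {u} → Closed x u → Closed x (cyl y u)
  cyl-closed {x} y p = cyl-comm x y ⨾ cyl-mono y p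

  cyl-absorb : ∀ {x q w} → Closed x q → q ∧ cyl x w ≲ cyl x (q ∧ w)
  cyl-absorb {x} p =
    ∧-greatest ∧-lowerʳ (∧-lowerˡ ⨾ cyl-inc x) ⨾ cyl-∧ x
    ⨾ cyl-mono x (∧-greatest (∧-lowerʳ ⨾ p) ∧-lowerˡ)

  Cyl : List ℕ → Carrier → Carrier
  Cyl []       u = u
  Cyl (x ∷ xs) u = cyl x (Cyl xs u)

  Cyl-mono : ∀ xs {u v} → u ≲ v → Cyl xs u ≲ Cyl xs v
  Cyl-mono []       p = p
  Cyl-mono (x ∷ xs) p = cyl-mono x (Cyl-mono xs p)

  Cyl-inc : ∀ xs {u} → u ≲ Cyl xs u
  Cyl-inc []       = ≲-refl
  Cyl-inc (x ∷ xs) = Cyl-inc xs ⨾ cyl-inc x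

  Cyl-closed : ∀ xs {k u} → Closed k u → Closed k (Cyl xs u)
  Cyl-closed []       p = p
  Cyl-closed (x ∷ xs) p = cyl-closed x (Cyl-closed xs p)

  Cyl-closed-∈ : ∀ {xs k u} → k ∈ xs → Closed k (Cyl xs u)
  Cyl-closed-∈ (here refl)         = cyl-idem _
  Cyl-closed-∈ {x ∷ _} (there k∈) = cyl-closed x (Cyl-closed-∈ k∈)

  Cyl-elim : ∀ xs {u} → (∀ {k} → k ∈ xs → Closed k u) → Cyl xs u ≲ u
  Cyl-elim []       p = ≲-refl
  Cyl-elim (x ∷ xs) p = cyl-mono x (Cyl-elim xs (p ∘ there)) ⨾ p (here refl)

  Cyl-absorb : ∀ xs {q w} → (∀ {k} → k ∈ xs → Closed k q) → q ∧ Cyl xs w ≲ Cyl xs (q ∧ w)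
  Cyl-absorb []       p = ≲-refl
  Cyl-absorb (x ∷ xs) p =
    cyl-absorb (p (here refl)) ⨾ cyl-mono x (Cyl-absorb xs (p ∘ there))

  Cyl-cyl-comm : ∀ xs x {u} → Cyl xs (cyl x u) ≲ cyl x (Cyl xs u)
  Cyl-cyl-comm []       x = ≲-refl
  Cyl-cyl-comm (y ∷ xs) x = cyl-mono y (Cyl-cyl-comm xs x) ⨾ cyl-comm y x

  ⋀d : List (ℕ × ℕ) → Carrier
  ⋀d []             = 1#
  ⋀d ((x , y) ∷ ps) = d x y ∧ ⋀d ps

  ⋀d-lookup : ∀ {ps x y} → (x , y) ∈ ps → ⋀d ps ≲ d x y
  ⋀d-lookup (here refl) = ∧-lowerˡ
  ⋀d-lookup (there p)   = ∧-lowerʳ ⨾ ⋀d-lookup p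

  ⋀d-greatest : ∀ ps {w} → (∀ {x y} → (x , y) ∈ ps → w ≲ d x y) → w ≲ ⋀d ps
  ⋀d-greatest []       p = 1-greatest
  ⋀d-greatest (_ ∷ ps) p = ∧-greatest (p (here refl)) (⋀d-greatest ps (p ∘ there))

  ⋀d-closed : ∀ ps {k} → (∀ {x y} → (x , y) ∈ ps → k ≢ x × k ≢ y) → Closed k (⋀d ps)
  ⋀d-closed []       p = 1-closed
  ⋀d-closed (_ ∷ ps) p with k≢x , k≢y ← p (here refl) =
    ∧-closed (d-closed k≢x k≢y) (⋀d-closed ps (p ∘ there))

  -- The equations x = y for (x , y) in ps define a simultaneous substitution.

  Fresh : ℕ × ℕ → ℕ × ℕ → Set
  Fresh (x , y) (x′ , _) = x′ ≢ x × x′ ≢ y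

  Substitution : List (ℕ × ℕ) → Set
  Substitution ps = All (λ (x , y) → x ≢ y) ps × AllPairs Fresh ps

  sources : List (ℕ × ℕ) → List ℕ
  sources = map proj₁

  private
    fresh-closed : ∀ {x y ps} → All (Fresh (x , y)) ps →
                   ∀ {k} → k ∈ sources ps → Closed k (d x y)
    fresh-closed fs k∈ with _ , p∈ , refl ← ∈-map⁻ proj₁ k∈
      with k≢x , k≢y ← All.lookup fs p∈ = d-closed k≢x k≢y

  ⋀d-total : ∀ {ps} → Substitution ps → 1# ≲ Cyl (sources ps) (⋀d ps)
  ⋀d-total {[]}           _                    = ≲-refl
  ⋀d-total {(x , _) ∷ ps} (x≢y ∷ ≢s , fs ∷ fss) =
    d-total x≢y ⨾ cyl-mono x
      (∧-greatest ≲-refl (1-greatest ⨾ ⋀d-total (≢s , fss))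
       ⨾ Cyl-absorb (sources ps) (fresh-closed fs))

  ⋀d-subst : ∀ {ps u} → Substitution ps → ⋀d ps ∧ Cyl (sources ps) (⋀d ps ∧ u) ≲ u
  ⋀d-subst {[]}           _                     = ∧-lowerʳ ⨾ ∧-lowerʳ
  ⋀d-subst {(x , _) ∷ ps} (x≢y ∷ ≢s , fs ∷ fss) =
    ∧-greatest (∧-lowerˡ ⨾ ∧-lowerʳ)
      (∧-mono ∧-lowerˡ (cyl-mono x (∧-greatest
         (Cyl-mono (sources ps) (∧-lowerˡ ⨾ ∧-lowerˡ) ⨾ Cyl-elim (sources ps) (fresh-closed fs))
         (Cyl-mono (sources ps) (∧-greatest (∧-lowerˡ ⨾ ∧-lowerʳ) ∧-lowerʳ))))
       ⨾ d-subst x≢y)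
    ⨾ ⋀d-subst (≢s , fss)

-- A binary numeral is read as a program building a list: one digit prepends 0, the other
-- increments the head.

private
  increment : List ℕ → List ℕ
  increment []       = []
  increment (n ∷ ns) = suc n ∷ ns

  decodeᵇ : ℕᵇ → List ℕ
  decodeᵇ ℕᵇ.zero  = []
  decodeᵇ 2[1+ b ] = 0 ∷ decodeᵇ b
  decodeᵇ 1+[2 b ] = increment (decodeᵇ b)

  decodeᵇ-surjective : ∀ ns → ∃[ b ] decodeᵇ b ≡ ns
  decodeᵇ-surjective []       = ℕᵇ.zero , refl
  decodeᵇ-surjective (n ∷ ns) with b , eq ← decodeᵇ-surjective ns = go n
    where
    go : ∀ n → ∃[ b ] decodeᵇ b ≡ n ∷ ns
    go zero    = 2[1+ b ] , cong (0 ∷_) eq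
    go (suc n) with b′ , eq′ ← go n = 1+[2 b′ ] , cong increment eq′

decode : ℕ → List ℕ
decode = decodeᵇ ∘ ℕᵇ.fromℕ

decode-surjective : ∀ ns → ∃[ n ] decode n ≡ ns
decode-surjective ns with b , eq ← decodeᵇ-surjective ns =
  ℕᵇ.toℕ b , trans (cong decodeᵇ (fromℕ-toℕ b)) eq

at : List ℕ → ℕ → ℕ
at []       _       = 0
at (n ∷ _)  zero    = n
at (_ ∷ ns) (suc k) = at ns k

at-applyUpTo : ∀ f {n k} → k < n → at (applyUpTo f n) k ≡ f k
at-applyUpTo f {suc n} {zero}  _         = refl
at-applyUpTo f {suc n} {suc k} (s≤s k<n) = at-applyUpTo (f ∘ suc) k<n

module Henkin {a ℓ} (em : ExcludedMiddle ℓ) (W : CylindricSemilattice a ℓ) where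
  open CylindricProperties W

  record Index : Set (a ⊔ ℓ) where
    field
      root        : Carrier
      consistent  : ¬ (root ≲ 0#)
      goals       : List (Carrier × ℕ)
      size        : ℕ
      root-closed : ∀ k → size ≤ k → Closed k root

  -- The variables below size are the columns of rows; the variables from size on are the
  -- Henkin constants, the variable size + y naming the element y of the model.  Witnesses are
  -- only added for the pairs (u , x) among the goals, so that ω steps are enough even if the
  -- semilattice is uncountable.

  module Model (i : Index) where
    open Index i

    equations : List ℕ → (ℕ → ℕ) → List (ℕ × ℕ)
    equations xs t = map (λ x → x , size + t x) xs

    graph : List ℕ → (ℕ → ℕ) → Carrier
    graph xs t = ⋀d (equations xs t)

    Columns : List ℕ → Set
    Columns xs = Unique xs × All (_< size) xs

    private
      name≢ : ∀ {x y} → x < size → x ≢ size + y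
      name≢ {y = y} x<n = ℕ.<⇒≢ (ℕ.<-≤-trans x<n (ℕ.m≤m+n size y))

      sources-equations : ∀ xs t → sources (equations xs t) ≡ xs
      sources-equations xs t = trans (sym (map-∘ xs)) (map-id xs)

      substitution : ∀ {xs t} → Columns xs → Substitution (equations xs t)
      substitution {xs} {t} (xs! , xs<) =
        All.map⁺ (All.map name≢ xs<) , AllPairs.map⁺ (fresh xs! xs<)
        where
        fresh : ∀ {xs} → Unique xs → All (_< size) xs →
                AllPairs (λ x y → y ≢ x × y ≢ size + t x) xs
        fresh []         []       = []
        fresh (x∉ ∷ xs!) (_ ∷ xs<) =
          All.zipWith (λ (x≢y , y<) → x≢y ∘ sym , name≢ y<) (x∉ , xs<) ∷ fresh xs! xs<

    graph-total : ∀ {xs t} → Columns xs → 1# ≲ Cyl xs (graph xs t)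
    graph-total {xs} {t} cols =
      subst (λ ys → 1# ≲ Cyl ys (graph xs t)) (sources-equations xs t)
            (⋀d-total (substitution cols))

    graph-subst : ∀ {xs t u} → Columns xs → graph xs t ∧ Cyl xs (graph xs t ∧ u) ≲ u
    graph-subst {xs} {t} {u} cols =
      subst (λ ys → graph xs t ∧ Cyl ys (graph xs t ∧ u) ≲ u) (sources-equations xs t)
            (⋀d-subst (substitution cols))

    graph-lookup : ∀ {xs t x} → x ∈ xs → graph xs t ≲ d x (size + t x)
    graph-lookup x∈ = ⋀d-lookup (∈-map⁺ _ x∈)

    graph-greatest : ∀ xs {t w} → (∀ {x} → x ∈ xs → w ≲ d x (size + t x)) → w ≲ graph xs t
    graph-greatest xs {t} p = ⋀d-greatest (equations xs t) λ xy∈ → case ∈-map⁻ _ xy∈ of λ where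
      (_ , x∈ , refl) → p x∈

    graph-closed : ∀ xs {t k} → k < size → (∀ {x} → x ∈ xs → k ≢ x) → Closed k (graph xs t)
    graph-closed xs {t} k< p = ⋀d-closed (equations xs t) λ xy∈ → case ∈-map⁻ _ xy∈ of λ where
      (_ , x∈ , refl) → p x∈ , name≢ k<

    columns : List ℕ
    columns = upTo size

    columns-ok : Columns columns
    columns-ok = upTo⁺ size , All.tabulate ∈-upTo⁻

    -- root, with each of its variables x renamed to the constant size + x.
    start : Carrier
    start = Cyl columns (graph columns id ∧ root)

    private
      graph-id-closed : ∀ k → size + size ≤ k → Closed k (graph columns id)
      graph-id-closed k ≤k = ⋀d-closed (equations columns id) λ xy∈ → case ∈-map⁻ _ xy∈ of λ where
        (x , x∈ , refl) →
          let <k = ℕ.<-≤-trans (ℕ.+-monoʳ-< size (∈-upTo⁻ x∈)) ≤k in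
          ℕ.>⇒≢ (ℕ.≤-<-trans (ℕ.m≤n+m x size) <k) , ℕ.>⇒≢ <k

    -- conservative: eliminating the constants from size + size on gives back start.
    record State : Set (a ⊔ ℓ) where
      field
        facts        : Carrier
        limit        : ℕ
        size≤limit   : size + size ≤ limit
        high-closed  : ∀ k → limit ≤ k → Closed k facts
        low-closed   : ∀ k → k < size → Closed k facts
        conservative : ∀ w → (∀ k → size + size ≤ k → Closed k w) → facts ≲ w → start ≲ w

    open State

    initial : State
    initial = record
      { facts        = start
      ; limit        = size + size
      ; size≤limit   = ℕ.≤-refl
      ; high-closed  = λ k ≤k → Cyl-closed columns
          (∧-closed (graph-id-closed k ≤k) (root-closed k (ℕ.≤-trans (ℕ.m≤m+n size size) ≤k)))
      ; low-closed   = λ k k< → Cyl-closed-∈ (∈-upTo⁺ k<)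
      ; conservative = λ _ _ → id
      }

    Feasible : Carrier → Carrier × ℕ → Set ℓ
    Feasible p (v , x) =
      p ≲ cyl x v × (∀ {k} → k < size → k ≢ x → Closed k v) × Lift ℓ (x < size)

    Fulfilled : Carrier → Carrier × ℕ → Set ℓ
    Fulfilled p (v , x) = ∃[ y ] p ≲ cyl x (d x (size + y) ∧ v)

    private
      extend : (s : State) (r : Carrier × ℕ) → Feasible (facts s) r →
               ∃[ s′ ] facts s′ ≲ facts s × Fulfilled (facts s′) r
      extend s (v , x) (p≲ , v-closed , lift x<) = record
        { facts        = facts s ∧ q
        ; limit        = suc y
        ; size≤limit   = ℕ.≤-trans (size≤limit s) (ℕ.≤-trans s≤y (ℕ.n≤1+n y))
        ; high-closed  = λ k y<k → ∧-closed
            (high-closed s k (ℕ.≤-trans s≤y (ℕ.<⇒≤ y<k)))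
            (cyl-closed x (∧-closed
              (d-closed (ℕ.>⇒≢ (ℕ.<-trans x<y y<k)) (ℕ.>⇒≢ y<k))
              (proj₂ (bound v) k (ℕ.≤-trans v≤y (ℕ.<⇒≤ y<k)))))
        ; low-closed   = λ k k< → ∧-closed (low-closed s k k<) (q-low k k<)
        ; conservative = λ w w-closed p∧q≲w → conservative s w w-closed
            (p≲cyl ⨾ cyl-mono y p∧q≲w ⨾ w-closed y (ℕ.≤-trans (size≤limit s) s≤y))
        } , ∧-lowerˡ , (y ∸ size) ,
        subst (λ z → facts s ∧ q ≲ cyl x (d x z ∧ v)) (sym (ℕ.m+[n∸m]≡n size≤y)) ∧-lowerʳ
        where
        y = limit s ⊔ⁿ proj₁ (bound v)
        s≤y : limit s ≤ y
        s≤y = ℕ.m≤m⊔n _ _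
        v≤y : proj₁ (bound v) ≤ y
        v≤y = ℕ.m≤n⊔m _ _
        size≤y : size ≤ y
        size≤y = ℕ.≤-trans (ℕ.m≤m+n size size) (ℕ.≤-trans (size≤limit s) s≤y)
        x<y : x < y
        x<y = ℕ.<-≤-trans x< size≤y
        q : Carrier
        q = cyl x (d x y ∧ v)
        q-low : ∀ k → k < size → Closed k q
        q-low k k< with k ℕ.≟ x
        ... | yes refl = cyl-idem x
        ... | no  k≢x  = cyl-closed x
          (∧-closed (d-closed k≢x (ℕ.<⇒≢ (ℕ.<-≤-trans k< size≤y))) (v-closed k< k≢x))
        p≲cyl : facts s ≲ cyl y (facts s ∧ q)
        p≲cyl = ∧-greatest ≲-refl
          (p≲ ⨾ cyl-mono x
            (∧-greatest ≲-refl (1-greatest ⨾ d-total (ℕ.>⇒≢ x<y) ⨾ cyl-mono y d-sym)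
             ⨾ cyl-absorb (proj₂ (bound v) y v≤y)
             ⨾ cyl-mono y (∧-greatest ∧-lowerʳ ∧-lowerˡ))
           ⨾ cyl-comm x y)
          ⨾ cyl-absorb (high-closed s y s≤y)

    step : (s : State) (r : Carrier × ℕ) →
           ∃[ s′ ] facts s′ ≲ facts s × (Feasible (facts s) r → Fulfilled (facts s′) r)
    step s r with em {P = Feasible (facts s) r}
    ... | yes f with s′ , ≲s , done ← extend s r f = s′ , ≲s , λ _ → done
    ... | no ¬f = s , ≲-refl , λ f → contradiction f ¬f

    steps : (s : State) (rs : List (Carrier × ℕ)) →
            ∃[ s′ ] facts s′ ≲ facts s ×
                    (∀ {r} → r ∈ rs → Feasible (facts s) r → Fulfilled (facts s′) r)
    steps s []       = s , ≲-refl , λ ()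
    steps s (r ∷ rs)
      with s₁ , s₁≲ , done  ← step s r
      with s₂ , s₂≲ , dones ← steps s₁ rs =
      s₂ , s₂≲ ⨾ s₁≲ , λ where
        (here refl) f → map₂ (s₂≲ ⨾_) (done f)
        (there r∈)  (p≲ , f) → dones r∈ (s₁≲ ⨾ p≲ , f)

    others : ℕ → List ℕ
    others x = filter (λ k → ¬? (k ℕ.≟ x)) columns

    request : Carrier × ℕ → List ℕ → Carrier × ℕ
    request (u , x) ns = Cyl (others x) (graph (others x) (at ns) ∧ u) , x

    requests : ℕ → List (Carrier × ℕ)
    requests n = cartesianProductWith request goals (applyUpTo decode n)

    stage : ℕ → State
    stage zero    = initial
    stage (suc n) = proj₁ (steps (stage n) (requests n))

    theory : ℕ → Carrier
    theory = facts ∘ stage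

    theory-antitone : ∀ {m n} → m ≤ n → theory n ≲ theory m
    theory-antitone = go ∘ ℕ.≤⇒≤′
      where
      go : ∀ {m n} → m ≤′ n → theory n ≲ theory m
      go (≤′-reflexive refl) = ≲-refl
      go (≤′-step {n} m≤n)  = proj₁ (proj₂ (steps (stage n) (requests n))) ⨾ go m≤n

    theory-⊔ˡ : ∀ m n → theory (m ⊔ⁿ n) ≲ theory m
    theory-⊔ˡ m n = theory-antitone (ℕ.m≤m⊔n m n)

    theory-⊔ʳ : ∀ m n → theory (m ⊔ⁿ n) ≲ theory n
    theory-⊔ʳ m n = theory-antitone (ℕ.m≤n⊔m m n)

    infix 4 _∼_
    _∼_ : Rel ℕ ℓ
    y ∼ z = ∃[ n ] theory n ≲ d (size + y) (size + z)

    ∼-refl : ∀ {y} → y ∼ y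
    ∼-refl = 0 , 1-greatest ⨾ d-refl

    ∼-reflexive : ∀ {y z} → y ≡ z → y ∼ z
    ∼-reflexive refl = ∼-refl

    ∼-sym : ∀ {y z} → y ∼ z → z ∼ y
    ∼-sym = map₂ (_⨾ d-sym)

    ∼-trans : ∀ {x y z} → x ∼ y → y ∼ z → x ∼ z
    ∼-trans (m , p) (n , q) =
      m ⊔ⁿ n , ∧-greatest (theory-⊔ˡ m n ⨾ p) (theory-⊔ʳ m n ⨾ q) ⨾ d-trans

    Sat : (ℕ → ℕ) → Carrier → Set ℓ
    Sat t u = ∃[ n ] theory n ∧ graph columns t ≲ u

    Sat-mono : ∀ {t u v} → u ≲ v → Sat t u → Sat t v
    Sat-mono u≲v = map₂ (_⨾ u≲v)

    Sat-1 : ∀ {t} → Sat t 1#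
    Sat-1 = 0 , 1-greatest

    Sat-∧ : ∀ {t u v} → Sat t u → Sat t v → Sat t (u ∧ v)
    Sat-∧ (m , p) (n , q) = m ⊔ⁿ n ,
      ∧-greatest (∧-mono (theory-⊔ˡ m n) ≲-refl ⨾ p) (∧-mono (theory-⊔ʳ m n) ≲-refl ⨾ q)

    private
      theory-cyl : ∀ {n xs t u} → Columns xs → theory n ∧ graph xs t ≲ u → theory n ≲ Cyl xs u
      theory-cyl {n} {xs} cols p =
        ∧-greatest ≲-refl (1-greatest ⨾ graph-total cols)
        ⨾ Cyl-absorb xs (λ k∈ → low-closed (stage n) _ (All.lookup (proj₂ cols) k∈))
        ⨾ Cyl-mono xs p

    private
      start-reflect : ∀ {u} → (∀ k → size ≤ k → Closed k u) →
                      start ∧ graph columns id ≲ u → root ≲ u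
      start-reflect {u} u-closed p =
        ∧-greatest ≲-refl (1-greatest ⨾ ⋀d-total swapped-substitution)
        ⨾ Cyl-absorb (sources swapped) (λ {k} k∈ → root-closed k (swapped-sources k∈))
        ⨾ Cyl-mono (sources swapped)
            (∧-mono ≲-refl swapped≲
             ⨾ ∧-greatest (∧-greatest ∧-lowerʳ ∧-lowerˡ ⨾ Cyl-inc columns) ∧-lowerʳ ⨾ p)
        ⨾ Cyl-elim (sources swapped) (λ {k} k∈ → u-closed k (swapped-sources k∈))
        where
        swapped : List (ℕ × ℕ)
        swapped = map swap (equations columns id)
        swapped-sources : ∀ {k} → k ∈ sources swapped → size ≤ k
        swapped-sources k∈
          with _ , p∈ , refl ← ∈-map⁻ proj₁ k∈
          with _ , q∈ , refl ← ∈-map⁻ swap p∈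
          with x , _  , refl ← ∈-map⁻ (λ x → x , size + x) q∈ = ℕ.m≤m+n size x
        swapped≲ : ⋀d swapped ≲ graph columns id
        swapped≲ = ⋀d-greatest (equations columns id) λ xy∈ → ⋀d-lookup (∈-map⁺ swap xy∈) ⨾ d-sym
        swapped-substitution : Substitution swapped
        swapped-substitution =
          All.map⁺ (All.map⁺ (All.map (λ x< → name≢ x< ∘ sym) (proj₂ columns-ok))) ,
          AllPairs.map⁺ (AllPairs.map⁺ (fresh (proj₁ columns-ok) (proj₂ columns-ok)))
          where
          fresh : ∀ {xs} → Unique xs → All (_< size) xs →
                  AllPairs (λ x y → size + y ≢ size + x × size + y ≢ x) xs
          fresh []         []         = []
          fresh (x∉ ∷ xs!) (x< ∷ xs<) =
            All.map (λ x≢y → x≢y ∘ sym ∘ ℕ.+-cancelˡ-≡ size _ _ , name≢ x< ∘ sym) x∉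
            ∷ fresh xs! xs<

    Sat-root : Sat id root
    Sat-root = 0 , ∧-greatest ∧-lowerʳ ∧-lowerˡ ⨾ graph-subst columns-ok

    Sat-conservative : ∀ {u} → (∀ k → size ≤ k → Closed k u) → Sat id u → root ≲ u
    Sat-conservative {u} u-closed (n , p) =
      start-reflect u-closed
        (∧-greatest ∧-lowerʳ (∧-lowerˡ ⨾ start≲) ⨾ graph-subst columns-ok)
      where
      start≲ : start ≲ Cyl columns (graph columns id ∧ u)
      start≲ = conservative (stage n) _
        (λ k ≤k → Cyl-closed columns
          (∧-closed (graph-id-closed k ≤k) (u-closed k (ℕ.≤-trans (ℕ.m≤m+n size size) ≤k))))
        (theory-cyl {n} columns-ok (∧-greatest ∧-lowerʳ p))

    private
      reassign : ∀ {t t′ u} → (∀ {k} → k < size → t k ∼ t′ k ⊎ Closed k u) →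
                 ∀ xs → Columns xs → ∀ q → (∀ {k} → k ∈ xs → Closed k q) →
                 q ∧ graph xs t ≲ u → ∃[ m ] theory m ∧ q ∧ graph xs t′ ≲ u
      reassign same [] _ q _ p = 0 , ∧-lowerʳ ⨾ p
      reassign {t} {t′} same (x ∷ xs) (x∉ ∷ xs! , x< ∷ xs<) q q-closed p with same x<
      ... | inj₁ (m , e)
        with n , r ← reassign {t} {t′} same xs (xs! , xs<) (q ∧ d x (size + t′ x) ∧ theory m)
               (λ k∈ → ∧-closed (q-closed (there k∈)) (∧-closed
                 (d-closed (All.lookup x∉ k∈ ∘ sym) (name≢ (All.lookup xs< k∈)))
                 (low-closed (stage m) _ (All.lookup xs< k∈))))
               (∧-greatest (∧-lowerˡ ⨾ ∧-lowerˡ)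
                 (∧-mono (∧-lowerʳ ⨾ ∧-mono ≲-refl (e ⨾ d-sym) ⨾ d-trans) ≲-refl) ⨾ p) =
        m ⊔ⁿ n ,
        ∧-greatest (∧-lowerˡ ⨾ theory-⊔ʳ m n)
          (∧-greatest
            (∧-greatest (∧-lowerʳ ⨾ ∧-lowerˡ)
              (∧-greatest (∧-lowerʳ ⨾ ∧-lowerʳ ⨾ ∧-lowerˡ) (∧-lowerˡ ⨾ theory-⊔ˡ m n)))
            (∧-lowerʳ ⨾ ∧-lowerʳ ⨾ ∧-lowerʳ))
        ⨾ r
      ... | inj₂ u-closed =
        map₂ (∧-mono ≲-refl (∧-mono ≲-refl ∧-lowerʳ) ⨾_)
          (reassign {t} {t′} same xs (xs! , xs<) q (q-closed ∘ there)
            (∧-greatest ≲-refl (1-greatest ⨾ d-total (name≢ x<))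
             ⨾ cyl-absorb (∧-closed (q-closed (here refl))
                                    (graph-closed xs x< (All.lookup x∉)))
             ⨾ cyl-mono x (∧-greatest (∧-lowerˡ ⨾ ∧-lowerˡ)
                                      (∧-greatest ∧-lowerʳ (∧-lowerˡ ⨾ ∧-lowerʳ)) ⨾ p)
             ⨾ u-closed))

    Sat-resp : ∀ {t t′ u} → (∀ {k} → k < size → t k ∼ t′ k ⊎ Closed k u) → Sat t u → Sat t′ u
    Sat-resp {t} {t′} same (n , p)
      with m , q ← reassign {t} {t′} same columns columns-ok (theory n)
                     (λ k∈ → low-closed (stage n) _ (∈-upTo⁻ k∈)) p =
      m ⊔ⁿ n , ∧-greatest (∧-lowerˡ ⨾ theory-⊔ˡ m n) (∧-mono (theory-⊔ʳ m n) ≲-refl) ⨾ q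

    Sat-0 : ∀ {t} → ¬ Sat t 0#
    Sat-0 {t} s = consistent
      (Sat-conservative (λ k _ → cyl-0 k) (Sat-resp {t} (λ _ → inj₂ (cyl-0 _)) s))

    Sat-d⁺ : ∀ {t x y} → x < size → y < size → t x ∼ t y → Sat t (d x y)
    Sat-d⁺ x< y< (n , e) = n ,
      ∧-greatest
        (∧-lowerʳ ⨾ graph-lookup (∈-upTo⁺ x<))
        (∧-greatest (∧-lowerˡ ⨾ e) (∧-lowerʳ ⨾ graph-lookup (∈-upTo⁺ y<) ⨾ d-sym) ⨾ d-trans)
      ⨾ d-trans

    Sat-d⁻ : ∀ {t x y} → x < size → y < size → Sat t (d x y) → t x ∼ t y
    Sat-d⁻ x< y< (n , p) = n ,
      theory-cyl {n} columns-ok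
        (∧-greatest (∧-lowerʳ ⨾ graph-lookup (∈-upTo⁺ x<) ⨾ d-sym)
          (∧-greatest p (∧-lowerʳ ⨾ graph-lookup (∈-upTo⁺ y<)) ⨾ d-trans) ⨾ d-trans)
      ⨾ Cyl-elim columns (λ k∈ → d-closed (name≢ (∈-upTo⁻ k∈)) (name≢ (∈-upTo⁻ k∈)))

    Sat-witness : ∀ {t u x} → (u , x) ∈ goals → x < size → Sat t (cyl x u) →
                  ∃[ y ] ∀ t′ → t′ x ≡ y → (∀ {k} → k ≢ x → t′ k ≡ t k) → Sat t′ u
    Sat-witness {t} {u} {x} ux∈ x< (n , p) = y , λ t′ x≡ same → suc k ,
        ∧-greatest (∧-lowerʳ ⨾ columns≲others t′ same)
          (∧-greatest (∧-lowerʳ ⨾ graph-lookup (∈-upTo⁺ x<)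
                       ⨾ subst (λ z → d x (size + t′ x) ≲ d x (size + z)) x≡ ≲-refl)
                      (∧-lowerˡ ⨾ proj₂ fulfilled)
           ⨾ d-subst (name≢ x<))
        ⨾ graph-subst others-ok
      where
      ns = applyUpTo t size
      code = decode-surjective ns
      k = n ⊔ⁿ suc (proj₁ code)
      D = graph (others x) (at ns)
      others⁻ : ∀ {z} → z ∈ others x → z ∈ columns × z ≢ x
      others⁻ = ∈-filter⁻ (λ k → ¬? (k ℕ.≟ x)) {xs = columns}
      others⁺ : ∀ {z} → z < size → z ≢ x → z ∈ others x
      others⁺ z< z≢x = ∈-filter⁺ (λ k → ¬? (k ℕ.≟ x)) (∈-upTo⁺ z<) z≢x
      others-ok : Columns (others x)
      others-ok = filter⁺ _ (upTo⁺ size) , All.tabulate (∈-upTo⁻ ∘ proj₁ ∘ others⁻)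
      at-ns : ∀ {z} → z < size → at ns z ≡ t z
      at-ns = at-applyUpTo t
      columns≲others : ∀ t′ → (∀ {k} → k ≢ x → t′ k ≡ t k) → graph columns t′ ≲ D
      columns≲others t′ same = graph-greatest (others x) λ {z} z∈ →
        let z∈′ , z≢x = others⁻ z∈ in
        graph-lookup z∈′
        ⨾ subst (λ w → d z (size + t′ z) ≲ d z (size + w))
                (trans (same z≢x) (sym (at-ns (∈-upTo⁻ z∈′)))) ≲-refl
      others≲columns : D ∧ d x (size + t x) ≲ graph columns t
      others≲columns = graph-greatest columns lookup
        where
        lookup : ∀ {z} → z ∈ columns → D ∧ d x (size + t x) ≲ d z (size + t z)
        lookup {z} z∈ with z ℕ.≟ x
        ... | yes refl = ∧-lowerʳ
        ... | no  z≢x  =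
          ∧-lowerˡ ⨾ graph-lookup (others⁺ (∈-upTo⁻ z∈) z≢x)
          ⨾ subst (λ w → d z (size + at ns z) ≲ d z (size + w)) (at-ns (∈-upTo⁻ z∈)) ≲-refl
      D-closed : Closed x D
      D-closed = graph-closed (others x) x< λ z∈ → proj₂ (others⁻ z∈) ∘ sym
      theory≲ : theory k ≲ cyl x (Cyl (others x) (D ∧ u))
      theory≲ =
        theory-cyl {k} others-ok
          (∧-greatest ∧-lowerʳ
            (∧-greatest ≲-refl (1-greatest ⨾ d-total (name≢ x<))
             ⨾ cyl-absorb (∧-closed (low-closed (stage k) x x<) D-closed)
             ⨾ cyl-mono x
                 (∧-greatest (∧-lowerˡ ⨾ ∧-lowerˡ ⨾ theory-⊔ˡ n _)
                             (∧-mono ∧-lowerʳ ≲-refl ⨾ others≲columns) ⨾ p)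
             ⨾ cyl-idem x)
           ⨾ cyl-absorb D-closed)
        ⨾ Cyl-cyl-comm (others x) x
      request∈ : request (u , x) ns ∈ requests k
      request∈ = ∈-cartesianProductWith⁺ request ux∈
        (subst (_∈ applyUpTo decode k) (proj₂ code) (∈-applyUpTo⁺ decode (ℕ.m≤n⊔m n _)))
      fulfilled : Fulfilled (theory (suc k)) (request (u , x) ns)
      fulfilled = proj₂ (proj₂ (steps (stage k) (requests k))) request∈
        (theory≲ , (λ z< z≢x → Cyl-closed-∈ (others⁺ z< z≢x)) , lift x<)
      y = proj₁ fulfilled

  open Index

  Eventually : ∀ {p} → (Index → Set p) → Set (a ⊔ ℓ ⊔ p)
  Eventually P = ∃[ gs ] ∃[ n ] ∀ i → gs ⊆ goals i → n ≤ size i → P i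

  always : ∀ {p} {P : Index → Set p} → (∀ i → P i) → Eventually P
  always p = [] , 0 , λ i _ _ → p i

  eventually-map : ∀ {p q} {P : Index → Set p} {Q : Index → Set q} →
                   (∀ i → P i → Q i) → Eventually P → Eventually Q
  eventually-map f (gs , n , p) = gs , n , λ i g≤ n≤ → f i (p i g≤ n≤)

  eventually-zip : ∀ {p q r} {P : Index → Set p} {Q : Index → Set q} {R : Index → Set r} →
                   (∀ i → P i → Q i → R i) → Eventually P → Eventually Q → Eventually R
  eventually-zip f (gs , m , p) (hs , n , q) =
    gs ++ hs , m ⊔ⁿ n , λ i g≤ n≤ →
      f i (p i (g≤ ∘ ∈-++⁺ˡ) (ℕ.≤-trans (ℕ.m≤m⊔n m n) n≤))
          (q i (g≤ ∘ ∈-++⁺ʳ gs) (ℕ.≤-trans (ℕ.m≤n⊔m m n) n≤))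

  eventually-size : ∀ n → Eventually (λ i → n ≤ size i)
  eventually-size n = [] , n , λ _ _ n≤ → n≤

  eventually-goal : ∀ g → Eventually (λ i → g ∈ goals i)
  eventually-goal g = g ∷ [] , 0 , λ _ g≤ _ → g≤ (here refl)

  eventually-∈ : ∀ {b p} {B : Set b} {P : B → Index → Set p} (xs : List B) →
                 (∀ {x} → x ∈ xs → Eventually (P x)) → Eventually (λ i → ∀ {x} → x ∈ xs → P x i)
  eventually-∈ []       ps = always (λ _ ())
  eventually-∈ (x ∷ xs) ps =
    eventually-zip (λ i p q → λ where (here refl) → p ; (there x∈) → q x∈)
      (ps (here refl)) (eventually-∈ xs (ps ∘ there))

module Presence {v a ℓ d} {var : Set v} (em : ExcludedMiddle ℓ)
                (var↔ℕ : var ↔ ℕ) (V : ProjectionalSemilattice var a ℓ d) where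
  open ProjectionalSemilattice V public renaming (_≤_ to _⊑_)
  open IsBoundedMeetSemilattice _≈_ ps0
    using (isMagma; isSemigroup; isMeetSemilattice; ∧-cong; idem; comm; identityʳ)
  open IsEquivalence isEquivalence public
    using () renaming (refl to ≈-refl; sym to ≈-sym; trans to ≈-trans)
  open Inverse var↔ℕ public using (to; from; strictlyInverseˡ; strictlyInverseʳ)

  _≟_ : DecidableEquality var
  _≟_ = via-injection (↔⇒↣ var↔ℕ) ℕ._≟_

  ⊑-reflexive : ∀ {u v} → u ≈ v → u ⊑ v
  ⊑-reflexive = Natural.reflexive _≈_ _∧_ isMagma idem

  ⊑-antisym : ∀ {u v} → u ⊑ v → v ⊑ u → u ≈ v
  ⊑-antisym = Natural.antisym _≈_ _∧_ isEquivalence comm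

  infixr 5 _⨾_
  _⨾_ : ∀ {u v w} → u ⊑ v → v ⊑ w → u ⊑ w
  _⨾_ = Natural.trans _≈_ _∧_ isSemigroup

  ∧-⊑ˡ : ∀ {u v} → u ∧ v ⊑ u
  ∧-⊑ˡ = Natural.x∙y≤x _≈_ _∧_ isMeetSemilattice _ _

  ∧-⊑ʳ : ∀ {u v} → u ∧ v ⊑ v
  ∧-⊑ʳ = Natural.x∙y≤y _≈_ _∧_ isMeetSemilattice _ _

  ∧-⊑ : ∀ {u v w} → w ⊑ u → w ⊑ v → w ⊑ u ∧ v
  ∧-⊑ = Natural.∙-presʳ-≤ _≈_ _∧_ isMeetSemilattice _

  ⊑1 : ∀ {u} → u ⊑ 1#
  ⊑1 = ≈-sym (identityʳ _)

  ⊑0⇒≈0 : ∀ {u} → u ⊑ 0# → u ≈ 0#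
  ⊑0⇒≈0 p = ⊑-antisym p (0-least _)

  c-mono : ∀ x {u v} → u ⊑ v → c⟨ x ⟩ u ⊑ c⟨ x ⟩ v
  c-mono x p = ≈-trans (c-cong x (p ⨾ ps2 x _)) (ps3 x _ _)

  c-idem : ∀ x {u} → c⟨ x ⟩ (c⟨ x ⟩ u) ⊑ c⟨ x ⟩ u
  c-idem x = c-mono x (∧-⊑ ⊑1 (⊑-reflexive ≈-refl)) ⨾ ⊑-reflexive (ps3 x 1# _) ⨾ ∧-⊑ʳ

  closed⊎present : ∀ x u → c⟨ x ⟩ u ⊑ u ⊎ u ⊑ d⟨ x , x ⟩
  closed⊎present x u with em {u ≈ 0#} | em {u ≈ c⟨ x ⟩ u}
  ... | yes u≈0 | _       = inj₁ (⊑-reflexive (≈-trans (c-cong x u≈0) (ps1 x)) ⨾ 0-least u)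
  ... | no  _   | yes u≈c = inj₁ (⊑-reflexive (≈-sym u≈c))
  ... | no  u≉0 | no  u≉c = inj₂ (Equivalence.to (ps5 x u u≉0) u≉c)

  closed⇒absent : ∀ {x u} → u ≉ 0# → c⟨ x ⟩ u ⊑ u → ¬ (u ⊑ d⟨ x , x ⟩)
  closed⇒absent {x} {u} u≉0 cl p =
    Equivalence.from (ps5 x u u≉0) p (⊑-antisym (ps2 x u) cl)

  c-≉0 : ∀ {x u} → u ≉ 0# → c⟨ x ⟩ u ≉ 0#
  c-≉0 {x} {u} u≉0 c≈0 = u≉0 (⊑0⇒≈0 (ps2 x u ⨾ ⊑-reflexive c≈0))

  d-sym : ∀ {x y} → d⟨ x , y ⟩ ⊑ d⟨ y , x ⟩
  d-sym = ⊑-reflexive (ps12 _ _)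

  d-trans : ∀ {x y z} → d⟨ x , y ⟩ ∧ d⟨ y , z ⟩ ⊑ d⟨ x , z ⟩
  d-trans {x} {y} {z} with _≟_ y x | y ≟ z
  ... | yes refl | _        = ∧-⊑ʳ
  ... | no  _    | yes refl = ∧-⊑ˡ
  ... | no  y≢x  | no  y≢z  = ps2 y _ ⨾ ⊑-reflexive (≈-sym (ps6 y x z y≢x y≢z))

  d-presentˡ : ∀ {x y} → d⟨ x , y ⟩ ⊑ d⟨ x , x ⟩
  d-presentˡ = ∧-⊑ (⊑-reflexive ≈-refl) d-sym ⨾ d-trans

  d-closed : ∀ {x y z} → z ≢ x → z ≢ y → c⟨ z ⟩ d⟨ x , y ⟩ ⊑ d⟨ x , y ⟩
  d-closed {x} {y} {z} z≢x z≢y =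
    ⊑-reflexive (c-cong z d≈) ⨾ c-idem z ⨾ ⊑-reflexive (≈-sym d≈)
    where d≈ = ps6 z x y z≢x z≢y

  d-total : ∀ {x y} → x ≢ y → d⟨ y , y ⟩ ⊑ c⟨ x ⟩ d⟨ x , y ⟩
  d-total {x} {y} x≢y = ⊑-reflexive (ps6 x y y x≢y x≢y) ⨾ c-mono x ∧-⊑ʳ

  c-dxx : ∀ x → c⟨ x ⟩ d⟨ x , x ⟩ ≈ 1#
  c-dxx x = ps10 _ λ y y∈ →
    closed⇒absent (c-≉0 (ps11 x)) (closed y) (proj₁ (ps9 _) y∈)
    where
    closed : ∀ y → c⟨ y ⟩ (c⟨ x ⟩ d⟨ x , x ⟩) ⊑ c⟨ x ⟩ d⟨ x , x ⟩
    closed y with _≟_ y x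
    ... | yes refl = c-idem x
    ... | no  y≢x  = ⊑-reflexive (ps4 y x _) ⨾ c-mono x (d-closed y≢x y≢x)

  c-present : ∀ x {u} → c⟨ x ⟩ u ⊑ c⟨ x ⟩ (u ∧ d⟨ x , x ⟩)
  c-present x {u} with closed⊎present x u
  ... | inj₁ cl =
    ∧-⊑ (⊑1 ⨾ ⊑-reflexive (≈-sym (c-dxx x))) (⊑-reflexive ≈-refl)
    ⨾ ⊑-reflexive (≈-sym (ps3 x _ _)) ⨾ c-mono x (∧-⊑ (∧-⊑ʳ ⨾ cl) ∧-⊑ˡ)
  ... | inj₂ p  = c-mono x (∧-⊑ (⊑-reflexive ≈-refl) p)

  -- Up to ≲, the elements d⟨ x , x ⟩ are top, as they are in a cylindric algebra: the
  -- information which columns are present is forgotten.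

  infix 4 _≲_
  data _≲_ (u v : Carrier) : Set ℓ where
    incl    : u ⊑ v → u ≲ v
    present : ∀ k → u ∧ d⟨ from k , from k ⟩ ≲ v → u ≲ v

  ⊑-≲-trans : ∀ {u v w} → u ⊑ v → v ≲ w → u ≲ w
  ⊑-≲-trans p (incl q)      = incl (p ⨾ q)
  ⊑-≲-trans p (present k q) = present k (⊑-≲-trans (∧-⊑ (∧-⊑ˡ ⨾ p) ∧-⊑ʳ) q)

  ≲-trans : ∀ {u v w} → u ≲ v → v ≲ w → u ≲ w
  ≲-trans (incl p)      q = ⊑-≲-trans p q
  ≲-trans (present k p) q = present k (≲-trans p q)

  ≲-∧ : ∀ {u v w} → w ≲ u → w ≲ v → w ≲ u ∧ v
  ≲-∧ {u} {v} p q = go p (⊑-reflexive ≈-refl)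
    where
    base : ∀ {w} → w ⊑ u → w ≲ v → w ≲ u ∧ v
    base p (incl q)      = incl (∧-⊑ p q)
    base p (present k q) = present k (base (∧-⊑ˡ ⨾ p) q)
    go : ∀ {w} → w ≲ u → w ⊑ _ → w ≲ u ∧ v
    go (incl p)      r = base p (⊑-≲-trans r q)
    go (present k p) r = present k (go p (∧-⊑ˡ ⨾ r))

  ≲-c-mono : ∀ x {u v} → u ≲ v → c⟨ x ⟩ u ≲ c⟨ x ⟩ v
  ≲-c-mono x (incl p)          = incl (c-mono x p)
  ≲-c-mono x {u} (present k p) = present k (⊑-≲-trans c-∧-d (≲-c-mono x p))
    where
    y = from k
    c-∧-d : c⟨ x ⟩ u ∧ d⟨ y , y ⟩ ⊑ c⟨ x ⟩ (u ∧ d⟨ y , y ⟩)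
    c-∧-d with _≟_ x y
    ... | yes refl = ∧-⊑ˡ ⨾ c-present x
    ... | no  x≢y  = ∧-⊑ ∧-⊑ˡ (∧-⊑ʳ ⨾ ps2 x _) ⨾ ⊑-reflexive (≈-sym (ps3 x _ _))
                     ⨾ c-mono x (∧-⊑ ∧-⊑ˡ (∧-⊑ʳ ⨾ d-closed x≢y x≢y))

  ≲⇒⊑ : ∀ {u v} → (∀ x → c⟨ x ⟩ v ⊑ v ⊎ u ⊑ d⟨ x , x ⟩) → u ≲ v → u ⊑ v
  ≲⇒⊑ h (incl p)      = p
  ≲⇒⊑ h (present k p)
    with q ← ≲⇒⊑ (λ x → Sum.map₂ (∧-⊑ˡ ⨾_) (h x)) p | h (from k)
  ... | inj₁ cl = ps2 _ _ ⨾ c-present _ ⨾ c-mono _ q ⨾ cl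
  ... | inj₂ p′ = ∧-⊑ (⊑-reflexive ≈-refl) p′ ⨾ q

  absent⇒closed : ∀ {x u} → ¬ (u ⊑ d⟨ x , x ⟩) → c⟨ x ⟩ u ⊑ u
  absent⇒closed {x} {u} ¬p with closed⊎present x u
  ... | inj₁ cl = cl
  ... | inj₂ p  = contradiction p ¬p

  support : Carrier → List var
  support u with em {u ≈ 0#}
  ... | yes _  = []
  ... | no u≉0 = proj₁ (ps8 u u≉0)

  support-dom : ∀ {u} → u ≉ 0# → dom u ≐ (_∈ support u)
  support-dom {u} u≉0 with em {u ≈ 0#}
  ... | yes u≈0 = contradiction u≈0 u≉0
  ... | no u≉0′ = proj₂ (ps8 u u≉0′)

  present-support : ∀ {u x} → u ≉ 0# → u ⊑ d⟨ x , x ⟩ → x ∈ support u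
  present-support u≉0 p = proj₁ (support-dom u≉0) (proj₂ (ps9 _) p)

  support-present : ∀ {u x} → u ≉ 0# → x ∈ support u → u ⊑ d⟨ x , x ⟩
  support-present u≉0 x∈ = proj₁ (ps9 _) (proj₂ (support-dom u≉0) x∈)

  support-closed : ∀ u {x} → ¬ (x ∈ support u) → c⟨ x ⟩ u ⊑ u
  support-closed u {x} x∉ with em {u ≈ 0#}
  ... | yes u≈0 = ⊑-reflexive (≈-trans (c-cong x u≈0) (≈-trans (ps1 x) (≈-sym u≈0)))
  ... | no  u≉0 = absent⇒closed (x∉ ∘ proj₁ (proj₂ (ps8 u u≉0)) ∘ proj₂ (ps9 u))

  cylindric : CylindricSemilattice a ℓ
  cylindric = record
    { Carrier    = Carrier
    ; _≲_        = _≲_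
    ; _∧_        = _∧_
    ; 0#         = 0#
    ; 1#         = 1#
    ; cyl        = λ k → c⟨ from k ⟩
    ; d          = λ k l → d⟨ from k , from l ⟩
    ; ≲-refl     = incl (⊑-reflexive ≈-refl)
    ; ≲-trans    = ≲-trans
    ; ∧-lowerˡ   = incl ∧-⊑ˡ
    ; ∧-lowerʳ   = incl ∧-⊑ʳ
    ; ∧-greatest = ≲-∧
    ; 1-greatest = incl ⊑1
    ; cyl-mono   = λ k → ≲-c-mono (from k)
    ; cyl-inc    = λ k → incl (ps2 (from k) _)
    ; cyl-∧      = λ k → incl (⊑-reflexive (≈-sym (ps3 (from k) _ _)))
    ; cyl-idem   = λ k → incl (c-idem (from k))
    ; cyl-comm   = λ k l → incl (⊑-reflexive (ps4 (from k) (from l) _))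
    ; cyl-0      = λ k → incl (⊑-reflexive (ps1 (from k)))
    ; d-refl     = λ {k} → present k (incl ∧-⊑ʳ)
    ; d-sym      = incl d-sym
    ; d-trans    = incl d-trans
    ; d-closed   = λ k≢l k≢m → incl (d-closed (from-≢ k≢l) (from-≢ k≢m))
    ; d-total    = λ {_} {l} k≢l → present l (incl (∧-⊑ʳ ⨾ d-total (from-≢ k≢l)))
    ; d-subst    = λ k≢l → incl (ps7 _ _ _ (from-≢ k≢l))
    ; bound      = bound
    }
    where
    from-≢ : ∀ {k l} → k ≢ l → from k ≢ from l
    from-≢ {k} {l} k≢l eq =
      k≢l (trans (sym (strictlyInverseˡ k)) (trans (cong to eq) (strictlyInverseˡ l)))
    list-bound : ∀ xs → ∃[ m ] ∀ k → m ≤ k → ¬ (from k ∈ xs)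
    list-bound []       = 0 , λ _ _ ()
    list-bound (x ∷ xs) with m , p ← list-bound xs = suc (to x) ⊔ⁿ m , λ where
      k ≤k (here eq)  → ℕ.<-irrefl (trans (cong to (sym eq)) (strictlyInverseˡ k))
                          (ℕ.≤-trans (ℕ.m≤m⊔n _ m) ≤k)
      k ≤k (there k∈) → p k (ℕ.≤-trans (ℕ.m≤n⊔m (suc (to x)) m) ≤k) k∈
    bound : ∀ u → ∃[ m ] ∀ k → m ≤ k → c⟨ from k ⟩ u ≲ u
    bound u with m , p ← list-bound (support u) =
      m , λ k ≤k → incl (support-closed u (p k ≤k))

module Rows {v g e} {var : Set v} (var↔ℕ : var ↔ ℕ) (G : Setoid g e) where
  private module G = Setoid G
  open Tables var↔ℕ G
  open DecMembership _≟_ using (_∈?_)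

  ∈G^-resp : ∀ {r s X} → r ≈ʳ s → r ∈G^ X → s ∈G^ X
  ∈G^-resp r≈s (p , q) = (λ {x} j → p (is-just (Maybe.sym G.sym (r≈s x)) j)) ,
                         (λ {x} m → is-just (r≈s x) (q m))
    where
    is-just : ∀ {m n : Maybe G.Carrier} → m ≈ᵍ n → Is-just m → Is-just n
    is-just (just _) (just _) = just _

  ∈G^-≐ : ∀ {r X Y} → (_∈ X) ≐ (_∈ Y) → r ∈G^ X → r ∈G^ Y
  ∈G^-≐ (X⊆Y , Y⊆X) (p , q) = X⊆Y ∘ p , q ∘ Y⊆X

  ≈ᵍ-refl : ∀ {m} → m ≈ᵍ m
  ≈ᵍ-refl = Maybe.refl G.refl

  ≈ᵍ-reflexive : ∀ {m n} → m ≡ n → m ≈ᵍ n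
  ≈ᵍ-reflexive refl = ≈ᵍ-refl

  ∣-∈ : ∀ r X {x} → x ∈ X → (r ∣ X) x ≡ r x
  ∣-∈ r X {x} x∈ with x ∈? X
  ... | yes _ = refl
  ... | no x∉ = contradiction x∈ x∉

  ∣-defined : ∀ r X {x} → Is-just ((r ∣ X) x) → x ∈ X
  ∣-defined r X {x} j with yes x∈ ← x ∈? X = x∈

  ∣-∈G^ : ∀ {r X Y} → r ∈G^ X → Y ⊆ X → r ∣ Y ∈G^ Y
  ∣-∈G^ {r} {X} {Y} (_ , q) Y⊆X =
    ∣-defined r Y , λ y∈ → subst Is-just (sym (∣-∈ r Y y∈)) (q (Y⊆X y∈))

  ∣-≈ʳ : ∀ {r s X} → s ∈G^ X → (∀ {x} → x ∈ X → s x ≈ᵍ r x) → s ≈ʳ r ∣ X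
  ∣-≈ʳ {r} {s} {X} (p , _) same x with x ∈? X
  ... | yes x∈ = same x∈
  ... | no  x∉ with s x | p {x}
  ...   | just _  | q = contradiction (q (just _)) x∉
  ...   | nothing | _ = nothing

  ∖⁻ : ∀ X {x y} → y ∈ X ∖ x → y ∈ X × y ≢ x
  ∖⁻ X {x} = ∈-filter⁻ (λ y → ¬? (y ≟ x)) {xs = X}

  ∖⁺ : ∀ {X x y} → y ∈ X → y ≢ x → y ∈ X ∖ x
  ∖⁺ {x = x} = ∈-filter⁺ (λ y → ¬? (y ≟ x))

module Representation {v a ℓ d} (em : ExcludedMiddle (v ⊔ a ⊔ ℓ ⊔ d)) {var : Set v}
                      (var↔ℕ : var ↔ ℕ) (V : ProjectionalSemilattice var a ℓ d) where
  private
    L : Level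
    L = v ⊔ a ⊔ ℓ ⊔ d

    em-ℓ : ExcludedMiddle ℓ
    em-ℓ = map′ lower lift (em {Lift L _})

    epsilon : (P : ℕ → Set ℓ) → ∃[ n ] (∃ P → P n)
    epsilon P with em-ℓ {∃ P}
    ... | yes (n , p) = n , λ _ → p
    ... | no ¬p       = 0 , λ p → contradiction p ¬p

  open Presence em-ℓ var↔ℕ V hiding (_≟_)
  open Henkin em-ℓ cylindric
  open Index
  open Model

  -- The reduced product of the models, modulo the filter of Eventually.
  G : Setoid L L
  G = record
    { Carrier       = Lift L (Index → ℕ)
    ; _≈_           = λ (lift f) (lift g) → Lift L (Eventually λ i → _∼_ i (f i) (g i))
    ; isEquivalence = record
      { refl  = lift (always λ i → ∼-refl i)
      ; sym   = λ (lift p) → lift (eventually-map (λ i → ∼-sym i) p)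
      ; trans = λ (lift p) (lift q) → lift (eventually-zip (λ i → ∼-trans i) p q)
      }
    }

  private module G = Setoid G
  open Tables var↔ℕ G
  open Rows var↔ℕ G
  open DecMembership _≟_ using (_∈?_)

  entry : Maybe G.Carrier → Index → ℕ
  entry m i = maybe (λ g → lower g i) 0 m

  value : Row → Index → ℕ → ℕ
  value r i k = entry (r (from k)) i

  record Holds (r : Row) (u : Carrier) : Set (a ⊔ ℓ) where
    constructor holding
    field eventually : Eventually λ i → Sat i (value r i) u

  open Holds

  entry-cong : ∀ {m n} → m ≈ᵍ n → Eventually λ i → _∼_ i (entry m i) (entry n i)
  entry-cong (just (lift p)) = p
  entry-cong nothing         = always λ i → ∼-refl i

  Holds-mono : ∀ {r u v} → u ⊑ v → Holds r u → Holds r v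
  Holds-mono u⊑v (holding h) = holding (eventually-map (λ i → Sat-mono i (incl u⊑v)) h)

  Sat-support : ∀ i {t t′ u} → (∀ {k} → from k ∈ support u → _∼_ i (t k) (t′ k)) →
                Sat i t u → Sat i t′ u
  Sat-support i {t} {t′} {u} same = Sat-resp i λ {k} _ → by-cases k
    where
    by-cases : ∀ k → _∼_ i (t k) (t′ k) ⊎ c⟨ from k ⟩ u ≲ u
    by-cases k with from k ∈? support u
    ... | yes k∈ = inj₁ (same k∈)
    ... | no  k∉ = inj₂ (incl (support-closed u k∉))

  Holds-resp : ∀ {r s} u → (∀ {x} → x ∈ support u → r x ≈ᵍ s x) → Holds r u → Holds s u
  Holds-resp {r} {s} u same (holding h) = holding
    (eventually-zip (λ i eqs → Sat-support i {value r i} {value s i} {u} (λ k∈ → eqs k∈))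
      (eventually-∈ {P = λ x i → _∼_ i (entry (r x) i) (entry (s x) i)} (support u)
        (λ x∈ → entry-cong (same x∈))) h)

  1≉0 : 1# ≉ 0#
  1≉0 1≈0 = ps11 (from 0) (⊑0⇒≈0 (⊑1 ⨾ ⊑-reflexive 1≈0))

  ≲0⇒≈0 : ∀ {u} → u ≲ 0# → u ≈ 0#
  ≲0⇒≈0 = ⊑0⇒≈0 ∘ ≲⇒⊑ (λ x → inj₁ (⊑-reflexive (ps1 x)))

  Holds-0 : ∀ {r} → ¬ Holds r 0#
  Holds-0 (holding (gs , n , p)) = Sat-0 i (p i id ℕ.≤-refl)
    where
    i : Index
    i = record
      { root = 1# ; consistent = 1≉0 ∘ ≲0⇒≈0 ; goals = gs ; size = n
      ; root-closed = λ _ _ → incl ⊑1 }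

  Holds-≉0 : ∀ {r u} → Holds r u → u ≉ 0#
  Holds-≉0 h u≈0 = Holds-0 (Holds-mono (⊑-reflexive u≈0) h)

  φ : Carrier → Table
  φ u = record
    { rows      = λ r → r ∈G^ support u × Lift L (Holds r u)
    ; rows-resp = λ r≈s (r∈ , lift h) →
        ∈G^-resp r≈s r∈ , lift (Holds-resp u (λ {x} _ → r≈s x) h)
    ; columns   = support u
    ; rows⊆G^   = proj₁
    }

  support-mono : ∀ {u v} → u ≉ 0# → v ≉ 0# → u ⊑ v → support v ⊆ support u
  support-mono u≉0 v≉0 u⊑v x∈ = present-support u≉0 (u⊑v ⨾ support-present v≉0 x∈)

  φ-⊆ : ∀ {u v} → u ≈ v → ∀ {r} → rows (φ u) r → rows (φ v) r
  φ-⊆ u≈v (r∈ , lift h) = ∈G^-≐ (support-mono v≉0 u≉0 v⊑u , support-mono u≉0 v≉0 u⊑v) r∈ ,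
                          lift (Holds-mono u⊑v h)
    where
    u⊑v = ⊑-reflexive u≈v
    v⊑u = ⊑-reflexive (≈-sym u≈v)
    u≉0 = Holds-≉0 h
    v≉0 = λ v≈0 → u≉0 (≈-trans u≈v v≈0)

  φ-cong : ∀ {u v} → u ≈ v → φ u ≋ φ v
  φ-cong u≈v = φ-⊆ u≈v , φ-⊆ (≈-sym u≈v)

  support-∧ : ∀ {u v} → u ∧ v ≉ 0# → (_∈ support (u ∧ v)) ≐ (_∈ support u ++ support v)
  support-∧ {u} {v} uv≉0 = split , merge
    where
    u≉0 = λ u≈0 → uv≉0 (⊑0⇒≈0 (∧-⊑ˡ ⨾ ⊑-reflexive u≈0))
    v≉0 = λ v≈0 → uv≉0 (⊑0⇒≈0 (∧-⊑ʳ ⨾ ⊑-reflexive v≈0))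
    split : ∀ {x} → x ∈ support (u ∧ v) → x ∈ support u ++ support v
    split {x} x∈ with closed⊎present x u | closed⊎present x v
    ... | inj₂ p | _      = ∈-++⁺ˡ (present-support u≉0 p)
    ... | inj₁ _ | inj₂ p = ∈-++⁺ʳ (support u) (present-support v≉0 p)
    ... | inj₁ p | inj₁ q = contradiction (support-present uv≉0 x∈)
      (closed⇒absent uv≉0 (∧-⊑ (c-mono x ∧-⊑ˡ ⨾ p) (c-mono x ∧-⊑ʳ ⨾ q)))
    merge : ∀ {x} → x ∈ support u ++ support v → x ∈ support (u ∧ v)
    merge x∈ with ∈-++⁻ (support u) x∈
    ... | inj₁ x∈u = support-mono uv≉0 u≉0 ∧-⊑ˡ x∈u
    ... | inj₂ x∈v = support-mono uv≉0 v≉0 ∧-⊑ʳ x∈v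

  support-c : ∀ x {u} → u ≉ 0# → (_∈ support (c⟨ x ⟩ u)) ≐ (_∈ support u ∖ x)
  support-c x {u} u≉0 = below , above
    where
    below : ∀ {y} → y ∈ support (c⟨ x ⟩ u) → y ∈ support u ∖ x
    below {y} y∈ with p ← support-present (c-≉0 u≉0) y∈ | closed⊎present y u
    ... | inj₁ cl = contradiction p
      (closed⇒absent (c-≉0 u≉0) (⊑-reflexive (ps4 y x u) ⨾ c-mono x cl))
    ... | inj₂ q = ∖⁺ (present-support u≉0 q)
      λ where refl → closed⇒absent (c-≉0 u≉0) (c-idem x) p
    above : ∀ {y} → y ∈ support u ∖ x → y ∈ support (c⟨ x ⟩ u)
    above y∈ with y∈u , y≢x ← ∖⁻ (support u) y∈ = present-support (c-≉0 u≉0)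
      (c-mono x (support-present u≉0 y∈u) ⨾ d-closed (y≢x ∘ sym) (y≢x ∘ sym))

  d≉0 : ∀ x y → d⟨ x , y ⟩ ≉ 0#
  d≉0 x y d≈0 with x ≟ y
  ... | yes refl = ps11 x d≈0
  ... | no  x≢y  = ps11 y (⊑0⇒≈0
    (d-total x≢y ⨾ ⊑-reflexive (≈-trans (c-cong x d≈0) (ps1 x))))

  support-d : ∀ x y → (_∈ support d⟨ x , y ⟩) ≐ (_∈ x ∷ y ∷ [])
  support-d x y = below , above
    where
    below : ∀ {z} → z ∈ support d⟨ x , y ⟩ → z ∈ x ∷ y ∷ []
    below {z} z∈ with z ≟ x | z ≟ y
    ... | yes refl | _        = here refl
    ... | no  _    | yes refl = there (here refl)
    ... | no z≢x   | no z≢y   = contradiction (support-present (d≉0 x y) z∈)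
      (closed⇒absent (d≉0 x y) (d-closed z≢x z≢y))
    above : ∀ {z} → z ∈ x ∷ y ∷ [] → z ∈ support d⟨ x , y ⟩
    above (here refl)         = present-support (d≉0 x y) d-presentˡ
    above (there (here refl)) = present-support (d≉0 x y) (d-sym ⨾ d-presentˡ)

  φ-∧ : ∀ u v → φ (u ∧ v) ≋ φ u ⋈ φ v
  φ-∧ u v = split , merge
    where
    split : ∀ {r} → rows (φ (u ∧ v)) r → rows (φ u ⋈ φ v) r
    split {r} (r∈ , lift h) = r∈′ , restrict u ∈-++⁺ˡ ∧-⊑ˡ , restrict v (∈-++⁺ʳ (support u)) ∧-⊑ʳ
      where
      r∈′ = ∈G^-≐ (support-∧ (Holds-≉0 h)) r∈
      restrict : ∀ w → support w ⊆ support u ++ support v → u ∧ v ⊑ w →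
                 rows (φ w) (r ∣ support w)
      restrict w w⊆ p = ∣-∈G^ r∈′ w⊆ ,
        lift (Holds-resp w (≈ᵍ-reflexive ∘ sym ∘ ∣-∈ r (support w)) (Holds-mono p h))
    merge : ∀ {r} → rows (φ u ⋈ φ v) r → rows (φ (u ∧ v)) r
    merge {r} (r∈ , (_ , lift hu) , (_ , lift hv)) =
      ∈G^-≐ (swap (support-∧ (Holds-≉0 h))) r∈ , lift h
      where
      h : Holds r (u ∧ v)
      h = holding (eventually-zip (λ i → Sat-∧ i)
        (eventually (Holds-resp u (≈ᵍ-reflexive ∘ ∣-∈ r (support u)) hu))
        (eventually (Holds-resp v (≈ᵍ-reflexive ∘ ∣-∈ r (support v)) hv)))

  φ-0 : φ 0# ≋ ∅
  φ-0 = (λ (_ , lift h) → ⊥-elim (Holds-0 h)) , λ ()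

  φ-1 : φ 1# ≋ ｛⟨⟩｝
  φ-1 = (λ (r∈ , _) → ∣-≈ʳ′ (∈G^-≐ support-1 r∈)) ,
        (λ r≈ → ∈G^-≐ (swap support-1) (rows⊆G^ ｛⟨⟩｝ r≈) , lift (holding (always λ i → Sat-1 i)))
    where
    support-1 : (_∈ support 1#) ≐ (_∈ [])
    support-1 = (λ x∈ → contradiction (support-present 1≉0 x∈) (closed⇒absent 1≉0 ⊑1)) , λ ()
    ∣-≈ʳ′ : ∀ {r} → r ∈G^ [] → r ≈ʳ ⟨⟩
    ∣-≈ʳ′ r∈ = ∣-≈ʳ {⟨⟩} r∈ λ ()

  φ-c : ∀ x u → φ (c⟨ x ⟩ u) ≋ del x (φ u)
  φ-c x u = witness , project
    where
    project : ∀ {s} → rows (del x (φ u)) s → rows (φ (c⟨ x ⟩ u)) s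
    project {s} (r , (r∈ , lift h) , s≈) =
      ∈G^-resp (λ y → Maybe.sym G.sym (s≈ y))
        (∈G^-≐ (swap sup) (∣-∈G^ r∈ (proj₁ ∘ ∖⁻ (support u)))) ,
      lift (Holds-resp (c⟨ x ⟩ u)
        (λ {y} y∈ → Maybe.sym G.sym (subst (s y ≈ᵍ_) (∣-∈ r _ (proj₁ sup y∈)) (s≈ y)))
        (Holds-mono (ps2 x u) h))
      where sup = support-c x (Holds-≉0 h)
    unchanged : ∀ {s} → ¬ (x ∈ support u) → rows (φ (c⟨ x ⟩ u)) s → rows (del x (φ u)) s
    unchanged {s} x∉ (s∈ , lift h) =
      s , (∈G^-≐ same s∈ , lift (Holds-mono (support-closed u x∉) h)) ,
      ∣-≈ʳ (∈G^-≐ sup s∈) (λ _ → ≈ᵍ-refl)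
      where
      sup = support-c x λ u≈0 → Holds-≉0 h (≈-trans (c-cong x u≈0) (ps1 x))
      same : (_∈ support (c⟨ x ⟩ u)) ≐ (_∈ support u)
      same = proj₁ ∘ ∖⁻ (support u) ∘ proj₁ sup ,
             λ y∈ → proj₂ sup (∖⁺ y∈ λ where refl → x∉ y∈)
    witnessed : ∀ {s} → x ∈ support u → rows (φ (c⟨ x ⟩ u)) s → rows (del x (φ u)) s
    witnessed {s} x∈ (s∈ , lift (holding h)) =
      r , (r∈ , lift (holding holds)) ,
      ∣-≈ʳ {r} {s} (∈G^-≐ sup s∈) (≈ᵍ-reflexive ∘ sym ∘ r-other ∘ proj₂ ∘ ∖⁻ (support u))
      where
      sup = support-c x λ u≈0 → Holds-≉0 {s} (holding h) (≈-trans (c-cong x u≈0) (ps1 x))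
      Witness : Index → ℕ → Set ℓ
      Witness i y = ∀ t → t (to x) ≡ y → (∀ {k} → k ≢ to x → t k ≡ value s i k) → Sat i t u
      g : Index → ℕ
      g i = proj₁ (epsilon (Witness i))
      r : Row
      r y = if does (y ≟ x) then just (lift g) else s y
      r-x : ∀ {y} → y ≡ x → r y ≡ just (lift g)
      r-x {y} y≡x = cong (if_then just (lift g) else s y) (dec-true (y ≟ x) y≡x)
      r-other : ∀ {y} → y ≢ x → r y ≡ s y
      r-other {y} y≢x = cong (if_then just (lift g) else s y) (dec-false (y ≟ x) y≢x)
      r∈ : r ∈G^ support u
      r∈ = (λ {y} → only (y ≟ x)) , (λ {y} → all (y ≟ x))
        where
        only : ∀ {y} → Dec (y ≡ x) → Is-just (r y) → y ∈ support u
        only (yes refl) _ = x∈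
        only (no  y≢x)  j = proj₁ (∖⁻ (support u)
          (proj₁ sup (proj₁ s∈ (subst Is-just (r-other y≢x) j))))
        all : ∀ {y} → Dec (y ≡ x) → y ∈ support u → Is-just (r y)
        all (yes y≡x) _  = subst Is-just (sym (r-x y≡x)) (just _)
        all (no  y≢x) y∈ = subst Is-just (sym (r-other y≢x)) (proj₂ s∈ (proj₂ sup (∖⁺ y∈ y≢x)))
      holds : Eventually λ i → Sat i (value r i) u
      holds = eventually-map
        (λ i w → proj₂ (epsilon (Witness i)) w (value r i)
          (cong (λ m → entry m i) (r-x (strictlyInverseʳ x)))
          (λ k≢ → cong (λ m → entry m i)
            (r-other λ eq → k≢ (trans (sym (strictlyInverseˡ _)) (cong to eq)))))
        (eventually-zip
          (λ i (x< , ux∈) p → Sat-witness i {value s i} ux∈ x<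
            (subst (λ z → Sat i (value s i) (c⟨ z ⟩ u)) (sym (strictlyInverseʳ x)) p))
          (eventually-zip (λ _ → _,_) (eventually-size (suc (to x))) (eventually-goal (u , to x)))
          h)
    witness : ∀ {s} → rows (φ (c⟨ x ⟩ u)) s → rows (del x (φ u)) s
    witness s∈ = case x ∈? support u of λ where
      (yes x∈) → witnessed x∈ s∈
      (no  x∉) → unchanged x∉ s∈

  φ-d : ∀ x y → φ d⟨ x , y ⟩ ≋ E x y
  φ-d x y = equal , holds
    where
    Sat-d : ∀ i → to x < size i → to y < size i → ∀ {r} →
            (Sat i (value r i) d⟨ x , y ⟩ → _∼_ i (entry (r x) i) (entry (r y) i)) ×
            (_∼_ i (entry (r x) i) (entry (r y) i) → Sat i (value r i) d⟨ x , y ⟩)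
    Sat-d i x< y< {r} = subst₂
      (λ x y → (Sat i (value r i) d⟨ x , y ⟩ → _∼_ i (entry (r x) i) (entry (r y) i)) ×
               (_∼_ i (entry (r x) i) (entry (r y) i) → Sat i (value r i) d⟨ x , y ⟩))
      (strictlyInverseʳ x) (strictlyInverseʳ y)
      (Sat-d⁻ i {value r i} x< y< , Sat-d⁺ i {value r i} x< y<)
    sizes : Eventually λ i → to x < size i × to y < size i
    sizes = eventually-zip (λ _ → _,_) (eventually-size _) (eventually-size _)
    equal : ∀ {r} → rows (φ d⟨ x , y ⟩) r → rows (E x y) r
    equal {r} (r∈ , lift (holding h)) = r∈′ ,
      both (proj₂ r∈′ (here refl)) (proj₂ r∈′ (there (here refl)))
        (eventually-zip (λ i (x< , y<) → proj₁ (Sat-d i x< y< {r})) sizes h)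
      where
      r∈′ = ∈G^-≐ (support-d x y) r∈
      both : ∀ {m n} → Is-just m → Is-just n →
             Eventually (λ i → _∼_ i (entry m i) (entry n i)) → m ≈ᵍ n
      both (just _) (just _) p = just (lift p)
    holds : ∀ {r} → rows (E x y) r → rows (φ d⟨ x , y ⟩) r
    holds {r} (r∈ , rx≈ry) = ∈G^-≐ (swap (support-d x y)) r∈ ,
      lift (holding
        (eventually-zip (λ i (x< , y<) → proj₂ (Sat-d i x< y< {r})) sizes (entry-cong rx≈ry)))

  c⋆ : List var → Carrier → Carrier
  c⋆ xs u = foldr c⟨_⟩ u xs

  c⋆-≉0 : ∀ xs {u} → u ≉ 0# → c⋆ xs u ≉ 0#
  c⋆-≉0 []       u≉0 = u≉0
  c⋆-≉0 (x ∷ xs) u≉0 = c-≉0 (c⋆-≉0 xs u≉0)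

  c⋆-closed : ∀ xs {x u} → c⟨ x ⟩ u ⊑ u → c⟨ x ⟩ (c⋆ xs u) ⊑ c⋆ xs u
  c⋆-closed []       p = p
  c⋆-closed (y ∷ xs) p = ⊑-reflexive (ps4 _ y _) ⨾ c-mono y (c⋆-closed xs p)

  c⋆-closed-∈ : ∀ {xs x u} → x ∈ xs → c⟨ x ⟩ (c⋆ xs u) ⊑ c⋆ xs u
  c⋆-closed-∈ (here refl)        = c-idem _
  c⋆-closed-∈ {y ∷ _} (there x∈) = ⊑-reflexive (ps4 _ y _) ⨾ c-mono y (c⋆-closed-∈ x∈)

  c⋆-support : ∀ {u} → u ≉ 0# → c⋆ (support u) u ≈ 1#
  c⋆-support {u} u≉0 = ps10 _ λ x x∈ →
    closed⇒absent (c⋆-≉0 (support u) u≉0) (closed x) (proj₁ (ps9 _) x∈)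
    where
    closed : ∀ x → c⟨ x ⟩ (c⋆ (support u) u) ⊑ c⋆ (support u) u
    closed x with x ∈? support u
    ... | yes x∈ = c⋆-closed-∈ x∈
    ... | no  x∉ = c⋆-closed (support u) (support-closed u x∉)

  φ-nonempty : ∀ {u} → u ≉ 0# → NonEmpty (φ u)
  φ-nonempty {u} u≉0 =
    descend (support u) (⟨⟩ , φ-⊆ (≈-sym (c⋆-support u≉0)) (proj₂ φ-1 (λ _ → ≈ᵍ-refl)))
    where
    descend : ∀ xs → NonEmpty (φ (c⋆ xs u)) → NonEmpty (φ u)
    descend []       ne        = ne
    descend (x ∷ xs) (s , s∈) =
      let r , r∈ , _ = proj₁ (φ-c x (c⋆ xs u)) s∈ in descend xs (r , r∈)

  -- In the models with root u, a generic row of φ u is the identity on the columns of u.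
  Generic : Carrier → Row → Set (v ⊔ a ⊔ ℓ)
  Generic u r = ∀ i → root i ≈ u → ∀ {k} → from k ∈ support u → value r i k ≡ k

  φ-generic : ∀ {u} → u ≉ 0# → ∃[ r ] rows (φ u) r × Generic u r
  φ-generic {u} u≉0 =
    r , (r∈ , lift (holding (eventually-map (λ i → holds i em-ℓ) h₀))) , generic
    where
    r₀ : Row
    r₀ = proj₁ (φ-nonempty u≉0)
    h₀ : Eventually λ i → Sat i (value r₀ i) u
    h₀ = eventually (lower (proj₂ (proj₂ (φ-nonempty u≉0))))
    g : var → Index → ℕ
    g x i = if does (em-ℓ {root i ≈ u}) then to x else entry (r₀ x) i
    r : Row
    r = (λ x → just (lift (g x))) ∣ support u
    r-support : ∀ {x} → x ∈ support u → r x ≡ just (lift (g x))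
    r-support = ∣-∈ _ (support u)
    generic : Generic u r
    generic i root≈u {k} k∈ =
      trans (cong (λ m → entry m i) (r-support k∈))
        (trans (cong (if_then to (from k) else entry (r₀ (from k)) i) (dec-true em-ℓ root≈u))
               (strictlyInverseˡ k))
    r∈ : r ∈G^ support u
    r∈ = ∣-defined _ (support u) , λ x∈ → subst Is-just (sym (r-support x∈)) (just _)
    holds : ∀ i → Dec (root i ≈ u) → Sat i (value r₀ i) u → Sat i (value r i) u
    holds i (yes p) _ = Sat-support i {id} (λ k∈ → ∼-reflexive i (sym (generic i p k∈)))
      (Sat-mono i (incl (⊑-reflexive p)) (Sat-root i))
    holds i (no ¬p) = Sat-support i λ {k} k∈ → ∼-reflexive i (sym
      (trans (cong (λ m → entry m i) (r-support k∈))
             (cong (if_then to (from k) else entry (r₀ (from k)) i) (dec-false em-ℓ ¬p))))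

  φ-reflects : ∀ {u v r} → u ≉ 0# → rows (φ u) r → Generic u r → rows (φ v) r → u ⊑ v
  φ-reflects {u} {v} {r} u≉0 (r∈u , _) generic (r∈v , lift (holding (gs , n , p))) =
    ≲⇒⊑ (λ x → closed (x ∈? support v)) u≲v
    where
    bound-u = CylindricSemilattice.bound cylindric u
    bound-v = CylindricSemilattice.bound cylindric v
    v⊆u : support v ⊆ support u
    v⊆u x∈ = proj₁ r∈u (proj₂ r∈v x∈)
    closed : ∀ {x} → Dec (x ∈ support v) → c⟨ x ⟩ v ⊑ v ⊎ u ⊑ d⟨ x , x ⟩
    closed (yes x∈) = inj₂ (support-present u≉0 (v⊆u x∈))
    closed (no  x∉) = inj₁ (support-closed v x∉)
    i : Index
    i = record
      { root = u ; consistent = u≉0 ∘ ≲0⇒≈0 ; goals = gs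
      ; size = n ⊔ⁿ proj₁ bound-u ⊔ⁿ proj₁ bound-v
      ; root-closed = λ k ≤k → proj₂ bound-u k
          (ℕ.≤-trans (ℕ.≤-trans (ℕ.m≤n⊔m n _) (ℕ.m≤m⊔n _ (proj₁ bound-v))) ≤k) }
    Sat-v : Sat i id v
    Sat-v = Sat-support i (λ k∈ → ∼-reflexive i (generic i ≈-refl (v⊆u k∈)))
      (p i id (ℕ.≤-trans (ℕ.m≤m⊔n n _) (ℕ.m≤m⊔n _ (proj₁ bound-v))))
    u≲v : u ≲ v
    u≲v = Sat-conservative i
      (λ k ≤k → proj₂ bound-v k (ℕ.≤-trans (ℕ.m≤n⊔m (n ⊔ⁿ proj₁ bound-u) _) ≤k)) Sat-v

  φ-injective-⊑ : ∀ {u v} → φ u ≋ φ v → Dec (u ≈ 0#) → u ⊑ v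
  φ-injective-⊑ _         (yes u≈0) = ⊑-reflexive u≈0 ⨾ 0-least _
  φ-injective-⊑ (u⊆v , _) (no  u≉0) =
    let r , r∈ , generic = φ-generic u≉0 in φ-reflects u≉0 r∈ generic (u⊆v r∈)

  φ-injective : ∀ {u v} → φ u ≋ φ v → u ≈ v
  φ-injective {u} {v} eq =
    ⊑-antisym (φ-injective-⊑ {u} {v} eq em-ℓ) (φ-injective-⊑ {v} {u} (swap eq) em-ℓ)

  φ-dom : ∀ u → schema (φ u) ≐ dom u
  φ-dom u = by-cases em-ℓ
    where
    by-cases : Dec (u ≈ 0#) → schema (φ u) ≐ dom u
    by-cases (yes u≈0) = (λ _ → proj₂ (ps9 u) (⊑-reflexive u≈0 ⨾ 0-least _)) ,
                         λ _ (_ , _ , lift h) → contradiction u≈0 (Holds-≉0 h)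
    by-cases (no  u≉0) = (λ x∈ → proj₂ (support-dom u≉0) (x∈ (φ-nonempty u≉0))) ,
                         λ x∈ _ → proj₁ (support-dom u≉0) x∈

  image : ConjunctiveTableAlgebra
  image = record
    { universe      = λ T → ∃[ u ] φ u ≋ T
    ; universe-resp = λ S≋T (u , eq) → u , ≐-trans eq S≋T
    ; ∅-mem         = 0# , φ-0
    ; ｛⟨⟩｝-mem      = 1# , φ-1
    ; E-mem         = λ x y → d⟨ x , y ⟩ , φ-d x y
    ; ⋈-closed      = λ {S} {T} (u , p) (v , q) →
        u ∧ v , ≐-trans (φ-∧ u v) (⋈-cong {φ u} {S} {φ v} {T} p q)
    ; del-closed    = λ x {T} (u , p) → c⟨ x ⟩ u , ≐-trans (φ-c x u) (del-cong x {φ u} {T} p)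
    }

  isomorphism : Isomorphism V image
  isomorphism = record
    { bijection = record
      { to        = λ u → φ u , u , id , id
      ; cong      = φ-cong
      ; bijective = (λ {u} {v} → φ-injective {u} {v}) ,
                    λ (T , u , eq) → u , λ z≈u → ≐-trans (φ-cong z≈u) eq
      }
    ; φ-∧   = φ-∧
    ; φ-0   = φ-0
    ; φ-1   = φ-1
    ; φ-c   = φ-c
    ; φ-d   = φ-d
    ; φ-dom = φ-dom
    }

theorem3 : ∀ {v c ℓ d : Level} →
    ExcludedMiddle (v ⊔ c ⊔ ℓ ⊔ d) →
    (var : Set v) (var↔ℕ : var ↔ ℕ) →
    (V : ProjectionalSemilattice var c ℓ d) →
    Σ (Setoid (v ⊔ c ⊔ ℓ ⊔ d) (v ⊔ c ⊔ ℓ ⊔ d)) λ G →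
    let open Tables var↔ℕ G in
    Σ ConjunctiveTableAlgebra λ A → Isomorphism V A
theorem3 em var var↔ℕ V = G , image , isomorphism
  where open Representation em var↔ℕ V
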